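{- Let $n\in\mathbb{N}$, $n\ge1$. If Conjecture C holds for $n-1$ and the Lonely Vector Property holds for every natural number at most $n$, then every Strong Lonely Runner Zonotope $Z_{\mathbf v}\subseteq\mathbb{R}^{n-1}$ that violates Conjecture C for $n$, i.e. with $\mu(Z_{\mathbf v})>\frac{n-1}{n+1}$, contains at most $\binom{n+1}{2}^{n-1}$ points of $\mathbb{Z}^{n-1}$.
   Context: The covering radius of a convex body $M\subseteq\mathbb{R}^d$ is $\mu(M)=\min\{\rho>0:\rho M+\mathbb{Z}^d=\mathbb{R}^d\}$. For $\mathbf v=(v_1,\dots,v_m)\in\mathbb{Z}_{>0}^m$ with $\gcd(v_1,\dots,v_m)=1$, choose $\mathbf u_1,\dots,\mathbf u_m\in\mathbb{Z}^{m-1}$ that generate $\mathbb{Z}^{m-1}$ as a lattice and satisfy $\sum_{i=1}^m v_i\mathbf u_i=\mathbf 0$, and put $Z_{\mathbf v}=\sum_{i=1}^m[\mathbf 0,\mathbf u_i]\subseteq\mathbb{R}^{m-1}$; it is unique up to unimodular equivalence. $Z_{\mathbf v}$ is called a Strong Lonely Runner Zonotope (sLRZ) when the entries of $\mathbf v$ are pairwise distinct. "Conjecture C holds for $m$" (the zonotopal form of the shifted Lonely Runner Conjecture) means: every sLRZ $Z_{\mathbf v}$ of dimension $m-1$ satisfies $\mu(Z_{\mathbf v})\le\frac{m-1}{m+1}$ (vacuous for $m=0$). Lonely Vector Property (LVP): for a set $\mathbf P=\{\mathbf p_1,\dots,\mathbf p_k\}\subseteq\mathbb{R}^2$ of $k$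 non-zero vectors, not all parallel and no two equal or opposite to one another, let $S_{\mathbf P}$ be the multiset of cardinality $k^2$ given by $$S_{\mathbf P}=\mathbf P\cup\{\mathbf p_i+\mathbf p_j:1\le i<j\le k\}\cup\{\mathbf p_i-\mathbf p_j:1\le i<j\le k\}.$$ The set $\mathbf P$ satisfies the LVP if $S_{\mathbf P}$ contains a vector that is not parallel to any other vector in the multiset $S_{\mathbf P}$. The LVP holds for a natural number $k$ if every set of $k$ non-zero vectors in $\mathbb{Q}^2$, not all parallel and no two equal or opposite, satisfies the LVP. -}

module Defs where

open import Algebra.Bundles.Raw using (RawMonoid)
open import Algebra.Definitions.RawMonoid using (sum)
open import Data.Fin.Base as Fin using (Fin)
open import Data.Integer.Base as ℤ using (ℤ; +_; 0ℤ)
open import Data.Nat.Base as ℕ using (ℕ; zero; suc; _∸_)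
open import Data.Nat.GCD using (gcd)
import Data.Nat.Properties as ℕ
open import Data.Product.Base using (∃-syntax; Σ-syntax; _×_; _,_; zip′)
open import Data.Rational.Base as ℚ using (ℚ; 0ℚ; 1ℚ; ½; 1/_; ∣_∣)
import Data.Rational.Properties as ℚ
open import Data.Rational.Solver using (module +-*-Solver)
open import Data.Vec.Functional using (Vector; foldr)
open import Function.Definitions using (Injective)
open import Level using (0ℓ)
open import Relation.Binary.PropositionalEquality
  using (_≡_; _≢_; _≗_; refl; sym; trans; cong; cong₂; subst)
open import Relation.Nullary using (¬_)
open import Relation.Unary using (Pred)

-- Cauchy sequences of rationals, compared up to null sequences; under
-- excluded middle these are the classical real numbers.

Eventually : Pred ℕ 0ℓ → Set
Eventually P = ∃[ N ] ∀ n → N ℕ.≤ n → P n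

IsCauchy : (ℕ → ℚ) → Set
IsCauchy s = ∀ ε → 0ℚ ℚ.< ε →
  ∃[ N ] ∀ m n → N ℕ.≤ m → N ℕ.≤ n → ∣ s m ℚ.- s n ∣ ℚ.< ε

record ℝ : Set where
  constructor mkℝ
  field
    seq    : ℕ → ℚ
    cauchy : IsCauchy seq

open ℝ public

infix 4 _≈ᴿ_ _≤ᴿ_ _<ᴿ_

_≈ᴿ_ : ℝ → ℝ → Set
x ≈ᴿ y = ∀ ε → 0ℚ ℚ.< ε → Eventually λ n → ∣ seq x n ℚ.- seq y n ∣ ℚ.< ε

_≤ᴿ_ : ℝ → ℝ → Set
x ≤ᴿ y = ∀ ε → 0ℚ ℚ.< ε → Eventually λ n → seq x n ℚ.≤ seq y n ℚ.+ ε

_<ᴿ_ : ℝ → ℝ → Set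
x <ᴿ y = ∃[ ε ] 0ℚ ℚ.< ε × Eventually λ n → seq x n ℚ.+ ε ℚ.≤ seq y n

private
  open ℚ.≤-Reasoning
  open +-*-Solver using (solve; _:=_; _:+_; _:*_; _:-_)

  +-regroup : ∀ a b c d → (a ℚ.+ b) ℚ.- (c ℚ.+ d) ≡ (a ℚ.- c) ℚ.+ (b ℚ.- d)
  +-regroup = solve 4 (λ a b c d →
    (a :+ b) :- (c :+ d) := (a :- c) :+ (b :- d)) refl

  *-regroup : ∀ a b c d →
    a ℚ.* b ℚ.- c ℚ.* d ≡ a ℚ.* (b ℚ.- d) ℚ.+ d ℚ.* (a ℚ.- c)
  *-regroup = solve 4 (λ a b c d →
    a :* b :- c :* d := a :* (b :- d) :+ d :* (a :- c)) refl

  a≡b+[a-b] : ∀ a b → a ≡ b ℚ.+ (a ℚ.- b)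
  a≡b+[a-b] = solve 2 (λ a b → a := b :+ (a :- b)) refl

  halves : ∀ ε → ½ ℚ.* ε ℚ.+ ½ ℚ.* ε ≡ ε
  halves ε = trans (sym (ℚ.*-distribʳ-+ ε ½ ½)) (ℚ.*-identityˡ ε)

  ½-pos : ∀ {ε} → 0ℚ ℚ.< ε → 0ℚ ℚ.< ½ ℚ.* ε
  ½-pos {ε} ε>0 = subst (ℚ._< ½ ℚ.* ε) (ℚ.*-zeroʳ ½) (ℚ.*-monoʳ-<-pos ½ ε>0)

  +-cauchy : ∀ s t → IsCauchy s → IsCauchy t → IsCauchy (λ n → s n ℚ.+ t n)
  +-cauchy s t cs ct ε ε>0 =
    let M , close-s = cs (½ ℚ.* ε) (½-pos ε>0)
        N , close-t = ct (½ ℚ.* ε) (½-pos ε>0)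
    in M ℕ.⊔ N , λ m n m≥ n≥ → begin-strict
      ∣ (s m ℚ.+ t m) ℚ.- (s n ℚ.+ t n) ∣
        ≡⟨ cong ∣_∣ (+-regroup (s m) (t m) (s n) (t n)) ⟩
      ∣ (s m ℚ.- s n) ℚ.+ (t m ℚ.- t n) ∣
        ≤⟨ ℚ.∣p+q∣≤∣p∣+∣q∣ (s m ℚ.- s n) (t m ℚ.- t n) ⟩
      ∣ s m ℚ.- s n ∣ ℚ.+ ∣ t m ℚ.- t n ∣
        <⟨ ℚ.+-mono-< (close-s m n (ℕ.m⊔n≤o⇒m≤o M N m≥) (ℕ.m⊔n≤o⇒m≤o M N n≥))
                      (close-t m n (ℕ.m⊔n≤o⇒n≤o M N m≥) (ℕ.m⊔n≤o⇒n≤o M N n≥)) ⟩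
      ½ ℚ.* ε ℚ.+ ½ ℚ.* ε
        ≡⟨ halves ε ⟩
      ε ∎

  eventually-bounded : ∀ {s} → IsCauchy s →
    ∃[ B ] 0ℚ ℚ.< B × Eventually λ n → ∣ s n ∣ ℚ.≤ B
  eventually-bounded {s} cs =
    let N , close = cs 1ℚ (ℚ.positive⁻¹ 1ℚ)
    in ∣ s N ∣ ℚ.+ 1ℚ
     , ℚ.+-mono-≤-< (ℚ.0≤∣p∣ (s N)) (ℚ.positive⁻¹ 1ℚ)
     , N , λ n n≥ → begin
      ∣ s n ∣                        ≡⟨ cong ∣_∣ (a≡b+[a-b] (s n) (s N)) ⟩
      ∣ s N ℚ.+ (s n ℚ.- s N) ∣      ≤⟨ ℚ.∣p+q∣≤∣p∣+∣q∣ (s N) (s n ℚ.- s N) ⟩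
      ∣ s N ∣ ℚ.+ ∣ s n ℚ.- s N ∣    ≤⟨ ℚ.+-monoʳ-≤ ∣ s N ∣
                                         (ℚ.<⇒≤ (close n N n≥ ℕ.≤-refl)) ⟩
      ∣ s N ∣ ℚ.+ 1ℚ ∎

  shrink : ∀ B ε → 0ℚ ℚ.< B → 0ℚ ℚ.< ε →
    ∃[ δ ] 0ℚ ℚ.< δ × B ℚ.* δ ≡ ½ ℚ.* ε
  shrink B ε B>0 ε>0 =
    1/ B ℚ.* (½ ℚ.* ε)
    , subst (ℚ._< 1/ B ℚ.* (½ ℚ.* ε)) (ℚ.*-zeroʳ (1/ B))
        (ℚ.*-monoʳ-<-pos (1/ B) (½-pos ε>0))
    , trans (sym (ℚ.*-assoc B (1/ B) (½ ℚ.* ε)))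
        (trans (cong (ℚ._* (½ ℚ.* ε)) (ℚ.*-inverseʳ B))
          (ℚ.*-identityˡ (½ ℚ.* ε)))
    where
    instance
      B-pos     = ℚ.positive B>0
      B-nonZero = ℚ.pos⇒nonZero B {{ℚ.positive B>0}}
      1/B-pos   = ℚ.1/pos⇒pos B {{ℚ.positive B>0}}

  ∣*∣-bound : ∀ {a b B δ} → 0ℚ ℚ.< B → ∣ a ∣ ℚ.≤ B → ∣ b ∣ ℚ.< δ →
    ∣ a ℚ.* b ∣ ℚ.< B ℚ.* δ
  ∣*∣-bound {a} {b} {B} {δ} B>0 a≤B b<δ = begin-strict
    ∣ a ℚ.* b ∣        ≡⟨ ℚ.∣p*q∣≡∣p∣*∣q∣ a b ⟩
    ∣ a ∣ ℚ.* ∣ b ∣    ≤⟨ ℚ.*-monoʳ-≤-nonNeg ∣ b ∣ {{ℚ.nonNegative (ℚ.0≤∣p∣ b)}} a≤B ⟩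
    B ℚ.* ∣ b ∣        <⟨ ℚ.*-monoʳ-<-pos B {{ℚ.positive B>0}} b<δ ⟩
    B ℚ.* δ            ∎

  *-cauchy : ∀ s t → IsCauchy s → IsCauchy t → IsCauchy (λ n → s n ℚ.* t n)
  *-cauchy s t cs ct ε ε>0 =
    let B , B>0 , K , bound-s = eventually-bounded cs
        C , C>0 , L , bound-t = eventually-bounded ct
        δ , δ>0 , Bδ≡ = shrink B ε B>0 ε>0
        η , η>0 , Cη≡ = shrink C ε C>0 ε>0
        M , close-t = ct δ δ>0
        N , close-s = cs η η>0
    in (K ℕ.⊔ L) ℕ.⊔ (M ℕ.⊔ N) , λ m n m≥ n≥ →
      let m≥KL = ℕ.m⊔n≤o⇒m≤o (K ℕ.⊔ L) (M ℕ.⊔ N) m≥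
          n≥KL = ℕ.m⊔n≤o⇒m≤o (K ℕ.⊔ L) (M ℕ.⊔ N) n≥
          m≥MN = ℕ.m⊔n≤o⇒n≤o (K ℕ.⊔ L) (M ℕ.⊔ N) m≥
          n≥MN = ℕ.m⊔n≤o⇒n≤o (K ℕ.⊔ L) (M ℕ.⊔ N) n≥
      in begin-strict
      ∣ s m ℚ.* t m ℚ.- s n ℚ.* t n ∣
        ≡⟨ cong ∣_∣ (*-regroup (s m) (t m) (s n) (t n)) ⟩
      ∣ s m ℚ.* (t m ℚ.- t n) ℚ.+ t n ℚ.* (s m ℚ.- s n) ∣
        ≤⟨ ℚ.∣p+q∣≤∣p∣+∣q∣ (s m ℚ.* (t m ℚ.- t n)) (t n ℚ.* (s m ℚ.- s n)) ⟩
      ∣ s m ℚ.* (t m ℚ.- t n) ∣ ℚ.+ ∣ t n ℚ.* (s m ℚ.- s n) ∣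
        <⟨ ℚ.+-mono-<
             (∣*∣-bound {s m} B>0 (bound-s m (ℕ.m⊔n≤o⇒m≤o K L m≥KL))
               (close-t m n (ℕ.m⊔n≤o⇒m≤o M N m≥MN) (ℕ.m⊔n≤o⇒m≤o M N n≥MN)))
             (∣*∣-bound {t n} C>0 (bound-t n (ℕ.m⊔n≤o⇒n≤o K L n≥KL))
               (close-s m n (ℕ.m⊔n≤o⇒n≤o M N m≥MN) (ℕ.m⊔n≤o⇒n≤o M N n≥MN))) ⟩
      B ℚ.* δ ℚ.+ C ℚ.* η
        ≡⟨ cong₂ ℚ._+_ Bδ≡ Cη≡ ⟩
      ½ ℚ.* ε ℚ.+ ½ ℚ.* ε
        ≡⟨ halves ε ⟩
      ε ∎

infixl 6 _+ᴿ_
infixl 7 _*ᴿ_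

_+ᴿ_ : ℝ → ℝ → ℝ
x +ᴿ y = mkℝ (λ n → seq x n ℚ.+ seq y n) (+-cauchy (seq x) (seq y) (cauchy x) (cauchy y))

_*ᴿ_ : ℝ → ℝ → ℝ
x *ᴿ y = mkℝ (λ n → seq x n ℚ.* seq y n) (*-cauchy (seq x) (seq y) (cauchy x) (cauchy y))

fromℚ : ℚ → ℝ
fromℚ q = mkℝ (λ _ → q) λ ε ε>0 → 0 , λ _ _ _ _ →
  subst (ℚ._< ε) (sym (cong ∣_∣ (ℚ.+-inverseʳ q))) ε>0

fromℤ : ℤ → ℝ
fromℤ z = fromℚ (z ℚ./ 1)

0ᴿ 1ᴿ : ℝ
0ᴿ = fromℚ 0ℚ
1ᴿ = fromℚ 1ℚ

+ᴿ-0-rawMonoid : RawMonoid 0ℓ 0ℓ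
+ᴿ-0-rawMonoid = record { Carrier = ℝ ; _≈_ = _≈ᴿ_ ; _∙_ = _+ᴿ_ ; ε = 0ᴿ }

Σᴿ : ∀ {m} → Vector ℝ m → ℝ
Σᴿ = sum +ᴿ-0-rawMonoid

Σᶻ : ∀ {m} → Vector ℤ m → ℤ
Σᶻ = sum ℤ.+-0-rawMonoid

-- ρM + ℤᵈ = ℝᵈ, of which only ⊇ has content.
Covers : ∀ {d} → ℝ → Pred (Vector ℝ d) 0ℓ → Set
Covers {d} ρ M = (x : Vector ℝ d) →
  Σ[ y ∈ Vector ℝ d ] Σ[ z ∈ Vector ℤ d ] M y × (∀ j → x j ≈ᴿ ρ *ᴿ y j +ᴿ fromℤ (z j))

-- μ is the covering radius of M, i.e. min {ρ > 0 : ρM + ℤᵈ = ℝᵈ}.  In ℝ⁰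
-- every ρ > 0 covers, so that there is no minimum; there the covering
-- radius is 0, the infimum.
IsCoveringRadius : ∀ {d} → Pred (Vector ℝ d) 0ℓ → ℝ → Set
IsCoveringRadius {zero}  M μ = μ ≈ᴿ 0ᴿ
IsCoveringRadius {suc d} M μ =
  (0ᴿ <ᴿ μ × Covers μ M) × (∀ ρ → 0ᴿ <ᴿ ρ → Covers ρ M → μ ≤ᴿ ρ)

-- [0,u₁] + ⋯ + [0,uₘ]
Zonotope : ∀ {m d} → Vector (Vector ℤ d) m → Pred (Vector ℝ d) 0ℓ
Zonotope {m} u y = Σ[ t ∈ Vector ℝ m ]
  (∀ i → 0ᴿ ≤ᴿ t i × t i ≤ᴿ 1ᴿ) ×
  (∀ j → y j ≈ᴿ Σᴿ λ i → t i *ᴿ fromℤ (u i j))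

Generates : ∀ {m d} → Vector (Vector ℤ d) m → Set
Generates {m} {d} u = (z : Vector ℤ d) →
  Σ[ c ∈ Vector ℤ m ] (∀ j → z j ≡ Σᶻ λ i → c i ℤ.* u i j)

-- Zonotope u is a Strong Lonely Runner Zonotope Z_v.  For m = 0 this never
-- holds, the gcd of the empty family being 0.
record IsSLRZ {m} (v : Vector ℕ m) (u : Vector (Vector ℤ (m ∸ 1)) m) : Set where
  field
    positive  : ∀ i → 0 ℕ.< v i
    coprime   : foldr gcd 0 v ≡ 1
    distinct  : Injective _≡_ _≡_ v
    generates : Generates u
    relation  : ∀ j → Σᶻ (λ i → + v i ℤ.* u i j) ≡ 0ℤ

bound : ℕ → ℝ
bound m = fromℚ (+ (m ∸ 1) ℚ./ suc m)

-- μ is a relation rather than a function, hence the ∃; for these zonotopes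
-- the minimum exists classically and is unique up to _≈ᴿ_.
ConjectureC : ℕ → Set
ConjectureC m = (v : Vector ℕ m) (u : Vector (Vector ℤ (m ∸ 1)) m) → IsSLRZ v u →
  ∃[ μ ] IsCoveringRadius (Zonotope u) μ × μ ≤ᴿ bound m

AtMostLatticePoints : ∀ {d} → ℕ → Pred (Vector ℝ d) 0ℓ → Set
AtMostLatticePoints {d} N M = ∀ k (p : Vector (Vector ℤ d) k) →
  Injective _≡_ _≗_ p → (∀ i → M (λ j → fromℤ (p i j))) → k ℕ.≤ N

ℚ² : Set
ℚ² = ℚ × ℚ

0² : ℚ²
0² = 0ℚ , 0ℚ

infixl 6 _+²_ _-²_
infixr 7 _·²_

_+²_ _-²_ : ℚ² → ℚ² → ℚ²
_+²_ = zip′ ℚ._+_ ℚ._+_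
_-²_ = zip′ ℚ._-_ ℚ._-_

_·²_ : ℚ → ℚ² → ℚ²
c ·² (x , y) = c ℚ.* x , c ℚ.* y

-- For non-zero vectors this is symmetric; all vectors of S_P are non-zero
-- when no two members of P are equal or opposite.
Parallel : ℚ² → ℚ² → Set
Parallel a b = ∃[ c ] a ≡ c ·² b

-- The k² positions of the multiset S_P.
data Position (k : ℕ) : Set where
  single     : Fin k → Position k
  plus minus : (i j : Fin k) → .(i Fin.< j) → Position k

S : ∀ {k} → Vector ℚ² k → Position k → ℚ²
S p (single i)    = p i
S p (plus i j _)  = p i +² p j
S p (minus i j _) = p i -² p j

record Admissible {k} (p : Vector ℚ² k) : Set where
  field
    nonZero        : ∀ i → p i ≢ 0²
    notAllParallel : ¬ (∀ i j → Parallel (p i) (p j))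
    notEqual       : ∀ i j → i ≢ j → p i ≢ p j
    notOpposite    : ∀ i j → i ≢ j → p i ≢ 0² -² p j

SatisfiesLVP : ∀ {k} → Vector ℚ² k → Set
SatisfiesLVP p = ∃[ s ] ∀ t → t ≢ s → ¬ Parallel (S p s) (S p t)

LonelyVectorProperty : ℕ → Set
LonelyVectorProperty k = (p : Vector ℚ² k) → Admissible p → SatisfiesLVP p

{-# OPTIONS --safe #-}

-- If Z has more than Nⁿ⁻¹ lattice points, N = C(n+1, 2), then two of them are
-- congruent modulo N, so that Z contains a segment [q, q + Nw] with w = Σ wᵢuᵢ
-- a non-zero lattice vector.  A lonely vector s for the vectors pᵢ = (vᵢ , wᵢ)
-- gives integers fᵢ = det(s, pᵢ) which, one index b being left out, are
-- non-zero and have distinct absolute values.  Conjecture C for n − 1, read as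
-- the shifted Lonely Runner Conjecture and applied to these velocities, covers
-- modulo w with the dilation factor (n−2)/n; index b comes for free after a
-- shift along v.  The segment makes up for w at the cost of a further 1/N,
-- and (n−2)/n + 1/N = (n−1)/(n+1).

module Submission where

open import Defs
open import Algebra.Bundles using (CommutativeRing)
import Algebra.Properties.Group
import Algebra.Properties.Ring
import Algebra.Properties.Semiring.Sum
import Algebra.Solver.Ring
open import Algebra.Solver.Ring.AlmostCommutativeRing
  using (fromCommutativeRing; _-Raw-AlmostCommutative⟶_)
open import Axiom.ExcludedMiddle using (ExcludedMiddle)
open import Data.Empty using (⊥-elim; ⊥-elim-irr)
open import Data.Fin.Base as Fin using (Fin; zero; suc; punchIn; punchOut; fromℕ<; funToFin; finToFun)
import Data.Fin.Properties as Fin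
open import Data.Integer.Base as ℤ using (ℤ; +_; 0ℤ; 1ℤ)
open import Data.Integer.DivMod using (_%ℕ_; _/ℕ_; n%ℕd<d; a≡a%ℕn+[a/ℕn]*n)
import Data.Integer.Properties as ℤ
import Data.Integer.Solver
open import Data.Maybe.Base using (Maybe; just; nothing)
open import Data.Nat.Base as ℕ using (ℕ; zero; suc; _∸_; _^_; _≤_)
open import Data.Nat.Combinatorics using (_C_; nC1≡n; nCk+nC[k+1]≡[n+1]C[k+1])
open import Data.Nat.Divisibility using (_∣_; divides; ∣-trans; quotient)
open import Data.Nat.GCD using (gcd; gcd[m,n]∣m; gcd[m,n]∣n; module Bézout; module GCD)
import Data.Nat.Properties as ℕ
open import Data.Product.Base using (Σ-syntax; ∃-syntax; _×_; _,_; proj₁; proj₂)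
open import Data.Rational.Base as ℚ using (ℚ; 0ℚ; 1ℚ; ½; 1/_; ∣_∣; mkℚ)
import Data.Rational.Properties as ℚ
import Data.Rational.Solver
open import Data.Rational.Unnormalised.Base as ℚᵘ using (mkℚᵘ)
import Data.Rational.Unnormalised.Properties as ℚᵘ
open import Data.Sum.Base using (_⊎_; inj₁; inj₂; [_,_]′)
open import Data.Vec.Functional using (Vector; tail; _∷_; foldr)
open import Function.Base using (_$_; _∘_)
open import Function.Definitions using (Injective)
open import Level using (0ℓ)
import Relation.Binary.Reasoning.Setoid
open import Relation.Binary.Definitions using (tri<; tri≈; tri>)
open import Relation.Binary.PropositionalEquality as ≡
  using (_≡_; _≢_; _≗_; cong; cong₂; subst; subst₂)
open import Relation.Binary.Structures using (IsEquivalence)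
open import Relation.Nullary using (¬_; yes; no)
open import Relation.Unary using (Pred)

-- Adding a multiple of v to the coefficients of a point Σ tᵢuᵢ does not move it, so modulo w there
-- is a plane of directions, spanned by v and w, in which the coefficients may run. Each member s of
-- S_P stands for a linear form: a coordinate, or a sum or difference of two. If s₁ and s₂ are its
-- values at v and w, the form annihilates the direction s₁w - s₂v, whose entries are the
-- determinants. So one runner rests, or two run together or oppositely, and n - 1 runners are left
-- for Conjecture C. Loneliness says that no other form of this kind vanishes on the direction,
-- which is what distinctness of the remaining velocities requires. The starting positions must obey
-- the same tie as the velocities; as s₁ is non-zero, a shift along v achieves this. Two gaps remain
-- between such velocities and Conjecture C. Signs are removed by a reflection and a common factor
-- by a change of the time scale; generators uᵢ for the resulting coprime velocities have to be
-- constructed, which is done by induction with Bézout coefficients.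

module ∑ᶻ = Algebra.Properties.Semiring.Sum ℤ.+-*-semiring
module ℤSolver = Data.Integer.Solver.+-*-Solver
module ℚSolver = Data.Rational.Solver.+-*-Solver

-- Integers inside the rationals

infix 7.5 _/1
_/1 : ℤ → ℚ
z /1 = z ℚ./ 1

toℚᵘ-/1 : ∀ z → ℚ.toℚᵘ (z /1) ℚᵘ.≃ mkℚᵘ z 0
toℚᵘ-/1 z = ℚ.toℚᵘ-fromℚᵘ (mkℚᵘ z 0)

/1-+ : ∀ a b → (a ℤ.+ b) /1 ≡ a /1 ℚ.+ b /1
/1-+ a b = ℚ.toℚᵘ-injective (begin
  ℚ.toℚᵘ ((a ℤ.+ b) /1)                   ≈⟨ toℚᵘ-/1 (a ℤ.+ b) ⟩
  mkℚᵘ (a ℤ.+ b) 0                        ≈⟨ ℚᵘ.*≡* (cong₂ (λ x y → (x ℤ.+ y) ℤ.* 1ℤ)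
                                              (ℤ.*-identityʳ a) (ℤ.*-identityʳ b)) ⟨
  mkℚᵘ a 0 ℚᵘ.+ mkℚᵘ b 0                  ≈⟨ ℚᵘ.+-cong (toℚᵘ-/1 a) (toℚᵘ-/1 b) ⟨
  ℚ.toℚᵘ (a /1) ℚᵘ.+ ℚ.toℚᵘ (b /1)        ≈⟨ ℚ.toℚᵘ-homo-+ (a /1) (b /1) ⟨
  ℚ.toℚᵘ (a /1 ℚ.+ b /1)                  ∎)
  where open Relation.Binary.Reasoning.Setoid ℚᵘ.≃-setoid

/1-* : ∀ a b → (a ℤ.* b) /1 ≡ a /1 ℚ.* b /1
/1-* a b = ℚ.toℚᵘ-injective (begin
  ℚ.toℚᵘ ((a ℤ.* b) /1)                   ≈⟨ toℚᵘ-/1 (a ℤ.* b) ⟩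
  mkℚᵘ a 0 ℚᵘ.* mkℚᵘ b 0                  ≈⟨ ℚᵘ.*-cong (toℚᵘ-/1 a) (toℚᵘ-/1 b) ⟨
  ℚ.toℚᵘ (a /1) ℚᵘ.* ℚ.toℚᵘ (b /1)        ≈⟨ ℚ.toℚᵘ-homo-* (a /1) (b /1) ⟨
  ℚ.toℚᵘ (a /1 ℚ.* b /1)                  ∎)
  where open Relation.Binary.Reasoning.Setoid ℚᵘ.≃-setoid

-- Generators of a zonotope with given coprime velocities

-- Bézout's identity for `a` and `b` is divided by the gcd `d`, which is non-zero because `a` is.
-- The last equation is the unimodularity of the cofactors that `dual-∷` asks for.
cofactors : ∀ a b → 0 ℕ.< a → Σ[ d ∈ ℕ ] Σ[ a′ ∈ ℕ ] Σ[ b′ ∈ ℕ ] Σ[ α ∈ ℤ ] Σ[ β ∈ ℤ ]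
  a ≡ d ℕ.* a′ × b ≡ d ℕ.* b′ × α ℤ.* + a′ ℤ.+ β ℤ.* + b′ ≡ 1ℤ
cofactors a b a>0 with Bézout.lemma a b
... | Bézout.result d g bz with GCD.gcd∣m g | GCD.gcd∣n g
...   | divides a′ a≡ | divides b′ b≡ =
  d , a′ , b′ , proj₁ (αβ bz) , proj₁ (proj₂ (αβ bz)) ,
  ≡.trans a≡ (ℕ.*-comm a′ d) , ≡.trans b≡ (ℕ.*-comm b′ d) ,
  ℤ.*-cancelʳ-≡ _ 1ℤ (+ d) (proj₂ (proj₂ (αβ bz)))
  where
  open ℤSolver
  open ≡.≡-Reasoning
  instance
    d≢0 : ℕ.NonZero d
    d≢0 = ℕ.≢-nonZero λ d≡0 → ℕ.<⇒≢ a>0 (≡.sym (≡.trans a≡ (≡.trans (cong (a′ ℕ.*_) d≡0) (ℕ.*-zeroʳ a′))))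

  -- `Bézout.Identity` avoids subtraction by having two cases; they differ by exchanging `a` and
  -- `b`, so that `cast` serves both.
  cast : ∀ x y c c′ e e′ → e ≡ c ℕ.* d → e′ ≡ c′ ℕ.* d → d ℕ.+ y ℕ.* e′ ≡ x ℕ.* e →
    (+ x ℤ.* + c ℤ.+ ℤ.- + y ℤ.* + c′) ℤ.* + d ≡ 1ℤ ℤ.* + d
  cast x y c c′ _ _ ≡.refl ≡.refl eq = begin
    (+ x ℤ.* + c ℤ.+ ℤ.- + y ℤ.* + c′) ℤ.* + d
      ≡⟨ solve 5 (λ x y c c′ d → (x :* c :+ (:- y) :* c′) :* d :=
           x :* (c :* d) :+ (:- y) :* (c′ :* d)) ≡.refl (+ x) (+ y) (+ c) (+ c′) (+ d) ⟩
    + x ℤ.* (+ c ℤ.* + d) ℤ.+ ℤ.- + y ℤ.* (+ c′ ℤ.* + d)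
      ≡⟨ cong (ℤ._+ ℤ.- + y ℤ.* (+ c′ ℤ.* + d)) (begin
           + x ℤ.* (+ c ℤ.* + d)                ≡⟨ cong (λ t → + x ℤ.* t) (ℤ.pos-* c d) ⟨
           + x ℤ.* + (c ℕ.* d)                  ≡⟨ ℤ.pos-* x (c ℕ.* d) ⟨
           + (x ℕ.* (c ℕ.* d))                  ≡⟨ cong +_ eq ⟨
           + (d ℕ.+ y ℕ.* (c′ ℕ.* d))           ≡⟨ ℤ.pos-+ d (y ℕ.* (c′ ℕ.* d)) ⟩
           + d ℤ.+ + (y ℕ.* (c′ ℕ.* d))         ≡⟨ cong (λ t → + d ℤ.+ t) (ℤ.pos-* y (c′ ℕ.* d)) ⟩
           + d ℤ.+ + y ℤ.* + (c′ ℕ.* d)         ≡⟨ cong (λ z → + d ℤ.+ + y ℤ.* z) (ℤ.pos-* c′ d) ⟩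
           + d ℤ.+ + y ℤ.* (+ c′ ℤ.* + d)       ∎) ⟩
    (+ d ℤ.+ + y ℤ.* (+ c′ ℤ.* + d)) ℤ.+ ℤ.- + y ℤ.* (+ c′ ℤ.* + d)
      ≡⟨ solve 3 (λ d y m → (d :+ y :* m) :+ (:- y) :* m := con 1ℤ :* d) ≡.refl (+ d) (+ y) (+ c′ ℤ.* + d) ⟩
    1ℤ ℤ.* + d ∎

  αβ : Bézout.Identity d a b → Σ[ α ∈ ℤ ] Σ[ β ∈ ℤ ] (α ℤ.* + a′ ℤ.+ β ℤ.* + b′) ℤ.* + d ≡ 1ℤ ℤ.* + d
  αβ (Bézout.+- x y eq) = + x , ℤ.- + y , cast x y a′ b′ a b a≡ b≡ eq
  αβ (Bézout.-+ x y eq) = ℤ.- + x , + y ,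
    ≡.trans (cong (ℤ._* + d) (ℤ.+-comm (ℤ.- + x ℤ.* + a′) (+ y ℤ.* + b′))) (cast y x b′ a′ b a b≡ a≡ eq)

-- The columns of u together with b form a unimodular matrix sending r to
-- the last unit vector.
record Dual {d} (r : Vector ℕ (suc d)) : Set where
  field
    u         : Vector (Vector ℤ d) (suc d)
    b         : Vector ℤ (suc d)
    bezout    : Σᶻ (λ i → b i ℤ.* + r i) ≡ 1ℤ
    relation  : ∀ j → Σᶻ (λ i → + r i ℤ.* u i j) ≡ 0ℤ
    generates : Generates u
dual-ones : Dual {0} (λ _ → 1)
dual-ones = record
  { u         = λ _ ()
  ; b         = λ _ → 1ℤ
  ; bezout    = ≡.refl
  ; relation  = λ ()
  ; generates = λ _ → (λ _ → 0ℤ) , λ ()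
  }

-- The functional `b` takes the value 1 at `r`, which reduces the step to rank two: (a, g) is
-- annihilated by (g, -a) and sent to 1 by (α, β), and these two functionals together are
-- unimodular. Pulled back along `b` they are the new first column of `u` and the new `b`; the old
-- columns, extended by 0, annihilate `r` already.
dual-∷ : ∀ {d} {r : Vector ℕ (suc d)} (a g : ℕ) (α β : ℤ) →
  α ℤ.* + a ℤ.+ β ℤ.* + g ≡ 1ℤ → Dual r → Dual (a ∷ λ i → g ℕ.* r i)
dual-∷ {d} {r} a g α β αa+βg≡1 D = record
  { u         = u′
  ; b         = α ∷ λ i → β ℤ.* b i
  ; bezout    = bezout′
  ; relation  = relation′
  ; generates = generates′
  }
  where
  open Dual D
  open ℤSolver
  open ≡.≡-Reasoning

  u′ : Vector (Vector ℤ (suc d)) (suc (suc d))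
  u′ zero    = + g ∷ λ _ → 0ℤ
  u′ (suc i) = ℤ.- (+ a ℤ.* b i) ∷ u i

  Σ-scale : ∀ {n} c (f : Vector ℤ n) → Σᶻ (λ i → c ℤ.* f i) ≡ c ℤ.* Σᶻ f
  Σ-scale c f = ≡.sym (∑ᶻ.*-distribˡ-sum c f)

  bezout′ : α ℤ.* + a ℤ.+ Σᶻ (λ i → (β ℤ.* b i) ℤ.* + (g ℕ.* r i)) ≡ 1ℤ
  bezout′ = begin
    α ℤ.* + a ℤ.+ Σᶻ (λ i → (β ℤ.* b i) ℤ.* + (g ℕ.* r i))
      ≡⟨ cong (λ t → α ℤ.* + a ℤ.+ t) (∑ᶻ.sum-cong-≗ λ i →
           ≡.trans (cong (λ t → (β ℤ.* b i) ℤ.* t) (ℤ.pos-* g (r i)))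
             (solve 4 (λ β b g r → (β :* b) :* (g :* r) := (β :* g) :* (b :* r))
               ≡.refl β (b i) (+ g) (+ r i))) ⟩
    α ℤ.* + a ℤ.+ Σᶻ (λ i → (β ℤ.* + g) ℤ.* (b i ℤ.* + r i))
      ≡⟨ cong (λ t → α ℤ.* + a ℤ.+ t) (Σ-scale (β ℤ.* + g) (λ i → b i ℤ.* + r i)) ⟩
    α ℤ.* + a ℤ.+ (β ℤ.* + g) ℤ.* Σᶻ (λ i → b i ℤ.* + r i)
      ≡⟨ cong (λ t → α ℤ.* + a ℤ.+ t) (≡.trans (cong (λ t → (β ℤ.* + g) ℤ.* t) bezout) (ℤ.*-identityʳ _)) ⟩
    α ℤ.* + a ℤ.+ β ℤ.* + g ≡⟨ αa+βg≡1 ⟩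
    1ℤ ∎
    where open ≡.≡-Reasoning

  relation′ : ∀ j → Σᶻ (λ i → + (a ∷ λ i → g ℕ.* r i) i ℤ.* u′ i j) ≡ 0ℤ
  relation′ zero = begin
    + a ℤ.* + g ℤ.+ Σᶻ (λ i → + (g ℕ.* r i) ℤ.* ℤ.- (+ a ℤ.* b i))
      ≡⟨ cong (λ t → + a ℤ.* + g ℤ.+ t) (∑ᶻ.sum-cong-≗ λ i →
           ≡.trans (cong (ℤ._* ℤ.- (+ a ℤ.* b i)) (ℤ.pos-* g (r i)))
             (solve 4 (λ g r a b → (g :* r) :* (:- (a :* b)) := (:- (a :* g)) :* (b :* r))
               ≡.refl (+ g) (+ r i) (+ a) (b i))) ⟩
    + a ℤ.* + g ℤ.+ Σᶻ (λ i → (ℤ.- (+ a ℤ.* + g)) ℤ.* (b i ℤ.* + r i))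
      ≡⟨ cong (λ t → + a ℤ.* + g ℤ.+ t) (≡.trans (Σ-scale (ℤ.- (+ a ℤ.* + g)) (λ i → b i ℤ.* + r i))
           (≡.trans (cong (λ t → (ℤ.- (+ a ℤ.* + g)) ℤ.* t) bezout) (ℤ.*-identityʳ _))) ⟩
    + a ℤ.* + g ℤ.- + a ℤ.* + g
      ≡⟨ ℤ.+-inverseʳ (+ a ℤ.* + g) ⟩
    0ℤ ∎
  relation′ (suc j) = begin
    + a ℤ.* 0ℤ ℤ.+ Σᶻ (λ i → + (g ℕ.* r i) ℤ.* u i j)
      ≡⟨ cong₂ ℤ._+_ (ℤ.*-zeroʳ (+ a)) (∑ᶻ.sum-cong-≗ λ i →
           ≡.trans (cong (ℤ._* u i j) (ℤ.pos-* g (r i))) (ℤ.*-assoc (+ g) (+ r i) (u i j))) ⟩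
    0ℤ ℤ.+ Σᶻ (λ i → + g ℤ.* (+ r i ℤ.* u i j))
      ≡⟨ cong (λ t → 0ℤ ℤ.+ t) (≡.trans (Σ-scale (+ g) (λ i → + r i ℤ.* u i j))
           (≡.trans (cong (λ t → + g ℤ.* t) (relation j)) (ℤ.*-zeroʳ (+ g)))) ⟩
    0ℤ ∎
    where open ≡.≡-Reasoning

  generates′ : Generates u′
  generates′ z = c′ , λ where
      zero    → ≡.sym row₀
      (suc j) → ≡.sym (row j)
    where
    c = proj₁ (generates (tail z))
    -- Changing `c` along `r` leaves the old columns alone, so only column 0 has to be met. Its
    -- value for the `c′` below is h(αa + βg) - aΣbᵢcᵢ, which dictates `h`.
    h = z zero ℤ.+ + a ℤ.* Σᶻ (λ i → b i ℤ.* c i)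
    c′ : Vector ℤ (suc (suc d))
    c′ zero    = β ℤ.* h
    c′ (suc i) = c i ℤ.+ ℤ.- (α ℤ.* h) ℤ.* + r i

    Σ-split : ∀ {n} x y (f f′ : Vector ℤ n) →
      Σᶻ (λ i → x ℤ.* f i ℤ.+ y ℤ.* f′ i) ≡ x ℤ.* Σᶻ f ℤ.+ y ℤ.* Σᶻ f′
    Σ-split x y f f′ = ≡.trans (∑ᶻ.∑-distrib-+ (λ i → x ℤ.* f i) (λ i → y ℤ.* f′ i))
      (cong₂ ℤ._+_ (Σ-scale x f) (Σ-scale y f′))

    row₀ : (β ℤ.* h) ℤ.* + g ℤ.+ Σᶻ (λ i → c′ (suc i) ℤ.* ℤ.- (+ a ℤ.* b i)) ≡ z zero
    row₀ = begin
      (β ℤ.* h) ℤ.* + g ℤ.+ Σᶻ (λ i → c′ (suc i) ℤ.* ℤ.- (+ a ℤ.* b i))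
        ≡⟨ cong (λ t → (β ℤ.* h) ℤ.* + g ℤ.+ t) (∑ᶻ.sum-cong-≗ λ i →
             solve 5 (λ c e r a b → (c :+ (:- e) :* r) :* (:- (a :* b)) :=
                        (:- a) :* (b :* c) :+ (e :* a) :* (b :* r))
               ≡.refl (c i) (α ℤ.* h) (+ r i) (+ a) (b i)) ⟩
      (β ℤ.* h) ℤ.* + g ℤ.+ Σᶻ (λ i → (ℤ.- + a) ℤ.* (b i ℤ.* c i) ℤ.+ ((α ℤ.* h) ℤ.* + a) ℤ.* (b i ℤ.* + r i))
        ≡⟨ cong (λ t → (β ℤ.* h) ℤ.* + g ℤ.+ t) (Σ-split (ℤ.- + a) ((α ℤ.* h) ℤ.* + a) (λ i → b i ℤ.* c i) (λ i → b i ℤ.* + r i)) ⟩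
      (β ℤ.* h) ℤ.* + g ℤ.+ ((ℤ.- + a) ℤ.* Σᶻ (λ i → b i ℤ.* c i) ℤ.+ ((α ℤ.* h) ℤ.* + a) ℤ.* Σᶻ (λ i → b i ℤ.* + r i))
        ≡⟨ cong (λ t → (β ℤ.* h) ℤ.* + g ℤ.+ ((ℤ.- + a) ℤ.* Σᶻ (λ i → b i ℤ.* c i) ℤ.+ ((α ℤ.* h) ℤ.* + a) ℤ.* t)) bezout ⟩
      (β ℤ.* h) ℤ.* + g ℤ.+ ((ℤ.- + a) ℤ.* Σᶻ (λ i → b i ℤ.* c i) ℤ.+ ((α ℤ.* h) ℤ.* + a) ℤ.* 1ℤ)
        ≡⟨ solve 6 (λ α β a g z s → let h = z :+ a :* s in
             (β :* h) :* g :+ ((:- a) :* s :+ ((α :* h) :* a) :* con 1ℤ) :=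
             (α :* a :+ β :* g) :* h :+ (:- a) :* s)
             ≡.refl α β (+ a) (+ g) (z zero) (Σᶻ (λ i → b i ℤ.* c i)) ⟩
      (α ℤ.* + a ℤ.+ β ℤ.* + g) ℤ.* h ℤ.+ (ℤ.- + a) ℤ.* Σᶻ (λ i → b i ℤ.* c i)
        ≡⟨ cong (λ x → x ℤ.* h ℤ.+ (ℤ.- + a) ℤ.* Σᶻ (λ i → b i ℤ.* c i)) αa+βg≡1 ⟩
      1ℤ ℤ.* h ℤ.+ (ℤ.- + a) ℤ.* Σᶻ (λ i → b i ℤ.* c i)
        ≡⟨ solve 3 (λ a z s → con 1ℤ :* (z :+ a :* s) :+ (:- a) :* s := z)
             ≡.refl (+ a) (z zero) (Σᶻ (λ i → b i ℤ.* c i)) ⟩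
      z zero ∎

    row : ∀ j → (β ℤ.* h) ℤ.* 0ℤ ℤ.+ Σᶻ (λ i → c′ (suc i) ℤ.* u i j) ≡ z (suc j)
    row j = begin
      (β ℤ.* h) ℤ.* 0ℤ ℤ.+ Σᶻ (λ i → c′ (suc i) ℤ.* u i j)
        ≡⟨ cong₂ ℤ._+_ (ℤ.*-zeroʳ (β ℤ.* h)) (∑ᶻ.sum-cong-≗ λ i →
             solve 4 (λ c e r u → (c :+ e :* r) :* u := con 1ℤ :* (c :* u) :+ e :* (r :* u))
               ≡.refl (c i) (ℤ.- (α ℤ.* h)) (+ r i) (u i j)) ⟩
      0ℤ ℤ.+ Σᶻ (λ i → 1ℤ ℤ.* (c i ℤ.* u i j) ℤ.+ ℤ.- (α ℤ.* h) ℤ.* (+ r i ℤ.* u i j))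
        ≡⟨ cong (λ t → 0ℤ ℤ.+ t) (Σ-split 1ℤ (ℤ.- (α ℤ.* h)) (λ i → c i ℤ.* u i j) (λ i → + r i ℤ.* u i j)) ⟩
      0ℤ ℤ.+ (1ℤ ℤ.* Σᶻ (λ i → c i ℤ.* u i j) ℤ.+ ℤ.- (α ℤ.* h) ℤ.* Σᶻ (λ i → + r i ℤ.* u i j))
        ≡⟨ cong₂ (λ x y → 0ℤ ℤ.+ (1ℤ ℤ.* x ℤ.+ ℤ.- (α ℤ.* h) ℤ.* y))
             (≡.sym (proj₂ (generates (tail z)) j)) (relation j) ⟩
      0ℤ ℤ.+ (1ℤ ℤ.* z (suc j) ℤ.+ ℤ.- (α ℤ.* h) ℤ.* 0ℤ)
        ≡⟨ solve 2 (λ z e → con 0ℤ :+ (con 1ℤ :* z :+ e :* con 0ℤ) := z)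
             ≡.refl (z (suc j)) (ℤ.- (α ℤ.* h)) ⟩
      z (suc j) ∎

-- Linear algebra over an ordered ring containing ℚ

-- The geometric argument divides by non-zero rationals only, so a ring with a map `ι` from ℚ is
-- enough. Staying abstract also lets a ring solver with integer coefficients treat real numbers as
-- atoms.
record ℚ-Algebra : Set₁ where
  field
    commutativeRing : CommutativeRing 0ℓ 0ℓ
  open CommutativeRing commutativeRing public hiding (zero)
  field
    ι   : ℚ → Carrier
    ι-+ : ∀ p q → ι (p ℚ.+ q) ≈ ι p + ι q
    ι-* : ∀ p q → ι (p ℚ.* q) ≈ ι p * ι q
    ι-1 : ι 1ℚ ≈ 1#

-- The fractional part given by `floor` may equal 1. It serves as a weight in a convex combination,
-- for which both ends of [0, 1] are fine.
record OrderedℚAlgebra : Set₁ where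
  field
    algebra : ℚ-Algebra
  open ℚ-Algebra algebra public
  field
    NonNegative : Pred Carrier 0ℓ
    nonNeg-resp : ∀ {x y} → x ≈ y → NonNegative x → NonNegative y
    nonNeg-+    : ∀ {x y} → NonNegative x → NonNegative y → NonNegative (x + y)
    nonNeg-*    : ∀ {x y} → NonNegative x → NonNegative y → NonNegative (x * y)
    nonNeg-ι    : ∀ {q} → 0ℚ ℚ.≤ q → NonNegative (ι q)
    floor       : ∀ x → Σ[ z ∈ ℤ ] NonNegative (x - ι (z /1)) × NonNegative (ι 1ℚ - (x - ι (z /1)))

module ℚ-AlgebraProperties (A : ℚ-Algebra) where

  open ℚ-Algebra A
  open Algebra.Properties.Ring ring using (+-cancelˡ; +-inverseʳ-unique)
  open Relation.Binary.Reasoning.Setoid setoid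
  module ∑ = Algebra.Properties.Semiring.Sum semiring
  open ∑ public using (sum)

  ⟪_⟫ : ℤ → Carrier
  ⟪ z ⟫ = ι (z /1)

  ι-0 : ι 0ℚ ≈ 0#
  ι-0 = +-cancelˡ (ι 0ℚ) (ι 0ℚ) 0# (begin
    ι 0ℚ + ι 0ℚ     ≈⟨ ι-+ 0ℚ 0ℚ ⟨
    ι (0ℚ ℚ.+ 0ℚ)   ≡⟨ cong ι (ℚ.+-identityˡ 0ℚ) ⟩
    ι 0ℚ            ≈⟨ +-identityʳ (ι 0ℚ) ⟨
    ι 0ℚ + 0#       ∎)

  ⟪⟫-+ : ∀ a b → ⟪ a ℤ.+ b ⟫ ≈ ⟪ a ⟫ + ⟪ b ⟫
  ⟪⟫-+ a b = trans (reflexive (cong ι (/1-+ a b))) (ι-+ (a /1) (b /1))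

  ⟪⟫-* : ∀ a b → ⟪ a ℤ.* b ⟫ ≈ ⟪ a ⟫ * ⟪ b ⟫
  ⟪⟫-* a b = trans (reflexive (cong ι (/1-* a b))) (ι-* (a /1) (b /1))

  ⟪⟫-neg : ∀ a → ⟪ ℤ.- a ⟫ ≈ - ⟪ a ⟫
  ⟪⟫-neg a = +-inverseʳ-unique ⟪ a ⟫ ⟪ ℤ.- a ⟫ (begin
    ⟪ a ⟫ + ⟪ ℤ.- a ⟫   ≈⟨ ⟪⟫-+ a (ℤ.- a) ⟨
    ⟪ a ℤ.- a ⟫         ≡⟨ cong ⟪_⟫ (ℤ.+-inverseʳ a) ⟩
    ι 0ℚ                ≈⟨ ι-0 ⟩
    0#                  ∎)

  ⟪⟫-homomorphism : CommutativeRing.rawRing ℤ.+-*-commutativeRing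
                      -Raw-AlmostCommutative⟶ fromCommutativeRing commutativeRing
  ⟪⟫-homomorphism = record
    { ⟦_⟧    = ⟪_⟫
    ; +-homo = ⟪⟫-+
    ; *-homo = ⟪⟫-*
    ; -‿homo = ⟪⟫-neg
    ; 0-homo = ι-0
    ; 1-homo = ι-1
    }

  ⟪⟫-≟ : ∀ a b → Maybe (⟪ a ⟫ ≈ ⟪ b ⟫)
  ⟪⟫-≟ a b with a ℤ.≟ b
  ... | yes a≡b = just (reflexive (cong ⟪_⟫ a≡b))
  ... | no  _   = nothing

  open Algebra.Solver.Ring (CommutativeRing.rawRing ℤ.+-*-commutativeRing)
    (fromCommutativeRing commutativeRing) ⟪⟫-homomorphism ⟪⟫-≟ public
    using (solve; con; _:=_; _:+_; _:*_; _:-_; :-_)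

  sum-cong : ∀ {n} {f g : Vector Carrier n} → (∀ i → f i ≈ g i) → sum f ≈ sum g
  sum-cong = ∑.sum-cong-≋

  ⟪⟫-sum : ∀ {n} (f : Vector ℤ n) → ⟪ Σᶻ f ⟫ ≈ sum (λ i → ⟪ f i ⟫)
  ⟪⟫-sum {zero}  f = ι-0
  ⟪⟫-sum {suc n} f = trans (⟪⟫-+ (f zero) _) (+-congˡ (⟪⟫-sum (tail f)))

  sum-*-⟪⟫ : ∀ {n} c (f : Vector ℤ n) → sum (λ i → c * ⟪ f i ⟫) ≈ c * ⟪ Σᶻ f ⟫
  sum-*-⟪⟫ c f = trans (sym (∑.*-distribˡ-sum c (λ i → ⟪ f i ⟫))) (*-congˡ (sym (⟪⟫-sum f)))

  -- Two coefficient vectors of the same point differ by a kernel element. If that is `σ` times `r`,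
  -- then `σ` is a time in which runners with velocities `r` lead from one vector to the other.
  Kernel : ∀ {d} → Vector ℕ (suc d) → Vector (Vector ℤ d) (suc d) → Set
  Kernel {d} r u = (y : Vector Carrier (suc d)) → (∀ j → sum (λ i → y i * ⟪ u i j ⟫) ≈ 0#) →
    ∃[ σ ] ∀ i → y i ≈ σ * ⟪ + r i ⟫

  kernel-ones : Kernel (λ _ → 1) (Dual.u dual-ones)
  kernel-ones y _ = y zero , λ where
    zero → trans (sym (*-identityʳ (y zero))) (*-congˡ (sym ι-1))

  -- All coordinates but the first put the tail of `y` into the old kernel, so it is σ′r. The first
  -- then reads y₀g = aσ′, and as (a, g) is unimodular this forces (y₀, σ′) = σ(a, g) with σ = αy₀ +
  -- βσ′.
  kernel-∷ : ∀ {d} {r : Vector ℕ (suc d)} a g α β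
    (αa+βg≡1 : α ℤ.* + a ℤ.+ β ℤ.* + g ≡ 1ℤ) (D : Dual r) → Kernel r (Dual.u D) →
    Kernel (a ∷ λ i → g ℕ.* r i) (Dual.u (dual-∷ a g α β αa+βg≡1 D))
  kernel-∷ {d} {r} a g α β αa+βg≡1 D kernel = kernel′
    where
    open Dual D
    u′ = Dual.u (dual-∷ a g α β αa+βg≡1 D)

    unit : ⟪ α ⟫ * ⟪ + a ⟫ + ⟪ β ⟫ * ⟪ + g ⟫ ≈ 1#
    unit = begin
      ⟪ α ⟫ * ⟪ + a ⟫ + ⟪ β ⟫ * ⟪ + g ⟫    ≈⟨ +-cong (⟪⟫-* α (+ a)) (⟪⟫-* β (+ g)) ⟨
      ⟪ α ℤ.* + a ⟫ + ⟪ β ℤ.* + g ⟫        ≈⟨ ⟪⟫-+ (α ℤ.* + a) (β ℤ.* + g) ⟨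
      ⟪ α ℤ.* + a ℤ.+ β ℤ.* + g ⟫          ≡⟨ cong ⟪_⟫ αa+βg≡1 ⟩
      ι 1ℚ                                 ≈⟨ ι-1 ⟩
      1#                                   ∎

    kernel′ : (y : Vector Carrier (suc (suc d))) →
      (∀ j → sum (λ i → y i * ⟪ u′ i j ⟫) ≈ 0#) →
      ∃[ σ ] ∀ i → y i ≈ σ * ⟪ + (a ∷ λ i → g ℕ.* r i) i ⟫
    kernel′ y y∈ker = σ , λ where
        zero    → sym (begin
          σ * ⟪ + a ⟫
            ≈⟨ solve 5 (λ α β a y σ → (α :* y :+ β :* σ) :* a := (α :* a) :* y :+ β :* (a :* σ))
                 refl ⟪ α ⟫ ⟪ β ⟫ ⟪ + a ⟫ (y zero) σ′ ⟩
          (⟪ α ⟫ * ⟪ + a ⟫) * y zero + ⟪ β ⟫ * (⟪ + a ⟫ * σ′)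
            ≈⟨ +-congˡ (*-congˡ yg≈aσ′) ⟨
          (⟪ α ⟫ * ⟪ + a ⟫) * y zero + ⟪ β ⟫ * (y zero * ⟪ + g ⟫)
            ≈⟨ solve 5 (λ α β a g y → (α :* a) :* y :+ β :* (y :* g) := (α :* a :+ β :* g) :* y)
                 refl ⟪ α ⟫ ⟪ β ⟫ ⟪ + a ⟫ ⟪ + g ⟫ (y zero) ⟩
          (⟪ α ⟫ * ⟪ + a ⟫ + ⟪ β ⟫ * ⟪ + g ⟫) * y zero
            ≈⟨ *-congʳ unit ⟩
          1# * y zero
            ≈⟨ *-identityˡ (y zero) ⟩
          y zero ∎)
        (suc i) → sym (begin
          σ * ⟪ + (g ℕ.* r i) ⟫
            ≈⟨ *-congˡ (trans (reflexive (cong ⟪_⟫ (ℤ.pos-* g (r i)))) (⟪⟫-* (+ g) (+ r i))) ⟩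
          σ * (⟪ + g ⟫ * ⟪ + r i ⟫)
            ≈⟨ solve 6 (λ α β g r y σ → (α :* y :+ β :* σ) :* (g :* r) := (α :* (y :* g) :+ (β :* g) :* σ) :* r)
                 refl ⟪ α ⟫ ⟪ β ⟫ ⟪ + g ⟫ ⟪ + r i ⟫ (y zero) σ′ ⟩
          (⟪ α ⟫ * (y zero * ⟪ + g ⟫) + (⟪ β ⟫ * ⟪ + g ⟫) * σ′) * ⟪ + r i ⟫
            ≈⟨ *-congʳ (+-congʳ (*-congˡ yg≈aσ′)) ⟩
          (⟪ α ⟫ * (⟪ + a ⟫ * σ′) + (⟪ β ⟫ * ⟪ + g ⟫) * σ′) * ⟪ + r i ⟫
            ≈⟨ *-congʳ (solve 5 (λ α β a g σ → α :* (a :* σ) :+ (β :* g) :* σ := (α :* a :+ β :* g) :* σ)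
                 refl ⟪ α ⟫ ⟪ β ⟫ ⟪ + a ⟫ ⟪ + g ⟫ σ′) ⟩
          ((⟪ α ⟫ * ⟪ + a ⟫ + ⟪ β ⟫ * ⟪ + g ⟫) * σ′) * ⟪ + r i ⟫
            ≈⟨ *-congʳ (trans (*-congʳ unit) (*-identityˡ σ′)) ⟩
          σ′ * ⟪ + r i ⟫
            ≈⟨ y≈σ′r i ⟨
          y (suc i) ∎)
      where
      ker : ∀ j → sum (λ i → y (suc i) * ⟪ u i j ⟫) ≈ 0#
      ker j = begin
        sum (λ i → y (suc i) * ⟪ u i j ⟫)
          ≈⟨ +-identityˡ _ ⟨
        0# + sum (λ i → y (suc i) * ⟪ u i j ⟫)
          ≈⟨ +-congʳ (trans (*-congˡ ι-0) (zeroʳ (y zero))) ⟨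
        y zero * ⟪ 0ℤ ⟫ + sum (λ i → y (suc i) * ⟪ u i j ⟫)
          ≈⟨ y∈ker (suc j) ⟩
        0# ∎
      σ′     = proj₁ (kernel (tail y) ker)
      y≈σ′r  = proj₂ (kernel (tail y) ker)
      σ      = ⟪ α ⟫ * y zero + ⟪ β ⟫ * σ′

      tail-sum : sum (λ i → y (suc i) * ⟪ ℤ.- (+ a ℤ.* b i) ⟫) ≈ - (⟪ + a ⟫ * σ′)
      tail-sum = begin
        sum (λ i → y (suc i) * ⟪ ℤ.- (+ a ℤ.* b i) ⟫)
          ≈⟨ sum-cong (λ i → begin
               y (suc i) * ⟪ ℤ.- (+ a ℤ.* b i) ⟫
                 ≈⟨ *-cong (y≈σ′r i) (trans (⟪⟫-neg (+ a ℤ.* b i)) (-‿cong (⟪⟫-* (+ a) (b i)))) ⟩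
               (σ′ * ⟪ + r i ⟫) * - (⟪ + a ⟫ * ⟪ b i ⟫)
                 ≈⟨ solve 4 (λ σ r a b → (σ :* r) :* (:- (a :* b)) := (:- (a :* σ)) :* (b :* r))
                      refl σ′ ⟪ + r i ⟫ ⟪ + a ⟫ ⟪ b i ⟫ ⟩
               (- (⟪ + a ⟫ * σ′)) * (⟪ b i ⟫ * ⟪ + r i ⟫)
                 ≈⟨ *-congˡ (⟪⟫-* (b i) (+ r i)) ⟨
               (- (⟪ + a ⟫ * σ′)) * ⟪ b i ℤ.* + r i ⟫ ∎) ⟩
        sum (λ i → (- (⟪ + a ⟫ * σ′)) * ⟪ b i ℤ.* + r i ⟫)
          ≈⟨ sum-*-⟪⟫ _ (λ i → b i ℤ.* + r i) ⟩
        (- (⟪ + a ⟫ * σ′)) * ⟪ Σᶻ (λ i → b i ℤ.* + r i) ⟫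
          ≈⟨ *-congˡ (trans (reflexive (cong ⟪_⟫ bezout)) ι-1) ⟩
        (- (⟪ + a ⟫ * σ′)) * 1#
          ≈⟨ *-identityʳ _ ⟩
        - (⟪ + a ⟫ * σ′) ∎

      yg≈aσ′ : y zero * ⟪ + g ⟫ ≈ ⟪ + a ⟫ * σ′
      yg≈aσ′ = begin
        y zero * ⟪ + g ⟫
          ≈⟨ solve 2 (λ x y → x := (x :+ (:- y)) :+ y) refl (y zero * ⟪ + g ⟫) (⟪ + a ⟫ * σ′) ⟩
        (y zero * ⟪ + g ⟫ - ⟪ + a ⟫ * σ′) + ⟪ + a ⟫ * σ′
          ≈⟨ +-congʳ (trans (+-congˡ (sym tail-sum)) (y∈ker zero)) ⟩
        0# + ⟪ + a ⟫ * σ′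
          ≈⟨ +-identityˡ _ ⟩
        ⟪ + a ⟫ * σ′ ∎

  -- Conjecture C speaks of coprime velocities, hence the factor `g`. `Dual` and `Kernel` are built
  -- in one induction since the Bézout coefficients of each step enter both.
  primitiveMultiple : ∀ {d} (v : Vector ℕ (suc d)) → (∀ i → 0 ℕ.< v i) →
    ∃[ g ] Σ[ r ∈ Vector ℕ (suc d) ] (∀ i → v i ≡ g ℕ.* r i) × (Σ[ D ∈ Dual r ] Kernel r (Dual.u D))
  primitiveMultiple {zero}  v v>0 =
    v zero , (λ _ → 1) , (λ where zero → ≡.sym (ℕ.*-identityʳ (v zero))) , dual-ones , kernel-ones
  primitiveMultiple {suc d} v v>0
    with g , r , tail≡ , D , K ← primitiveMultiple (tail v) (λ i → v>0 (suc i))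
    with e , a′ , g′ , α , β , a≡ , g≡ , eq ← cofactors (v zero) g (v>0 zero) =
    e , (a′ ∷ λ i → g′ ℕ.* r i)
      , (λ where
          zero    → a≡
          (suc i) → ≡.trans (tail≡ i) (≡.trans (cong (ℕ._* r i) g≡) (ℕ.*-assoc e g′ (r i))))
      , dual-∷ a′ g′ α β eq D , kernel-∷ a′ g′ α β eq D K

-- Lonely vectors and determinants

/1-injective : ∀ {a b} → a /1 ≡ b /1 → a ≡ b
/1-injective {a} {b} eq with ℚ.fromℚᵘ-injective {mkℚᵘ a 0} {mkℚᵘ b 0} eq
... | ℚᵘ.*≡* a*1≡b*1 = ℤ.*-cancelʳ-≡ a b 1ℤ a*1≡b*1

/1-- : ∀ a b → (a ℤ.- b) /1 ≡ a /1 ℚ.- b /1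
/1-- a b = ≡.trans (/1-+ a (ℤ.- b)) (cong (a /1 ℚ.+_) (/1-neg b))
  where
  /1-neg : ∀ z → (ℤ.- z) /1 ≡ ℚ.- (z /1)
  /1-neg (+ zero)        = ≡.refl
  /1-neg (+ suc n)       = ≡.refl
  /1-neg ℤ.-[1+ n ]      = ≡.sym (Algebra.Properties.Group.⁻¹-involutive ℚ.+-0-group (+ suc n /1))

/1-inverse : ∀ {z} → z ≢ 0ℤ → ∃[ q ] z /1 ℚ.* q ≡ 1ℚ
/1-inverse {z} z≢0 = 1/ (z /1) , ℚ.*-inverseʳ (z /1)
  where
  instance
    z/1≢0 : ℚ.NonZero (z /1)
    z/1≢0 = ℚ.≢-nonZero λ eq → z≢0 (/1-injective eq)

coord : ∀ {k} → Vector ℤ k → Position k → ℤ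
coord x (single i)    = x i
coord x (plus i j _)  = x i ℤ.+ x j
coord x (minus i j _) = x i ℤ.- x j

pair : ∀ {k} → Vector ℤ k → Vector ℤ k → Vector ℚ² k
pair x y i = x i /1 , y i /1

S-pair : ∀ {k} (x y : Vector ℤ k) s → S (pair x y) s ≡ (coord x s /1 , coord y s /1)
S-pair x y (single i)    = ≡.refl
S-pair x y (plus i j _)  = cong₂ _,_ (≡.sym (/1-+ (x i) (x j))) (≡.sym (/1-+ (y i) (y j)))
S-pair x y (minus i j _) = cong₂ _,_ (≡.sym (/1-- (x i) (x j))) (≡.sym (/1-- (y i) (y j)))

-- The first coordinate is the one to divide by: in the application it is vᵢ or vᵢ ± vⱼ, non-zero by
-- `coord-≢0`.
parallel : ∀ a b c d → c ≢ 0ℤ → a ℤ.* d ≡ b ℤ.* c → Parallel (a /1 , b /1) (c /1 , d /1)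
parallel a b c d c≢0 ad≡bc with q , cq≡1 ← /1-inverse c≢0 = a /1 ℚ.* q , cong₂ _,_
  (begin
    a /1                     ≡⟨ ℚ.*-identityʳ (a /1) ⟨
    a /1 ℚ.* 1ℚ              ≡⟨ cong (a /1 ℚ.*_) cq≡1 ⟨
    a /1 ℚ.* (c /1 ℚ.* q)    ≡⟨ solve 3 (λ a c q → a :* (c :* q) := (a :* q) :* c) ≡.refl (a /1) (c /1) q ⟩
    (a /1 ℚ.* q) ℚ.* c /1    ∎)
  (begin
    b /1                     ≡⟨ ℚ.*-identityʳ (b /1) ⟨
    b /1 ℚ.* 1ℚ              ≡⟨ cong (b /1 ℚ.*_) cq≡1 ⟨
    b /1 ℚ.* (c /1 ℚ.* q)    ≡⟨ ℚ.*-assoc (b /1) (c /1) q ⟨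
    (b /1 ℚ.* c /1) ℚ.* q    ≡⟨ cong (ℚ._* q) (/1-* b c) ⟨
    (b ℤ.* c) /1 ℚ.* q       ≡⟨ cong (λ z → z /1 ℚ.* q) ad≡bc ⟨
    (a ℤ.* d) /1 ℚ.* q       ≡⟨ cong (ℚ._* q) (/1-* a d) ⟩
    (a /1 ℚ.* d /1) ℚ.* q    ≡⟨ solve 3 (λ a d q → (a :* d) :* q := (a :* q) :* d) ≡.refl (a /1) (d /1) q ⟩
    (a /1 ℚ.* q) ℚ.* d /1    ∎)
  where
  open ≡.≡-Reasoning
  open ℚSolver

parallel⁻¹ : ∀ a b c d → Parallel (a /1 , b /1) (c /1 , d /1) → a ℤ.* d ≡ b ℤ.* c
parallel⁻¹ a b c d (q , eq) = /1-injective $ begin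
  (a ℤ.* d) /1               ≡⟨ /1-* a d ⟩
  a /1 ℚ.* d /1              ≡⟨ cong (ℚ._* d /1) (cong proj₁ eq) ⟩
  (q ℚ.* c /1) ℚ.* d /1      ≡⟨ solve 3 (λ q c d → (q :* c) :* d := (q :* d) :* c) ≡.refl q (c /1) (d /1) ⟩
  (q ℚ.* d /1) ℚ.* c /1      ≡⟨ cong (ℚ._* c /1) (cong proj₂ eq) ⟨
  b /1 ℚ.* c /1              ≡⟨ /1-* b c ⟨
  (b ℤ.* c) /1               ∎
  where
  open ≡.≡-Reasoning
  open ℚSolver

module _ {k} (v : Vector ℕ k) where

  -- The determinants of S p s with the vectors pᵢ = (vᵢ , wᵢ).
  dets : Vector ℤ k → Position k → Vector ℤ k
  dets w s i = coord (λ i → + v i) s ℤ.* w i ℤ.- coord w s ℤ.* + v i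

  -- The determinant is linear in its second argument. Thus a zero velocity, two equal ones and two
  -- opposite ones are all the same event: a member of S_P parallel to the one at `s`.
  coord-dets : ∀ w s t → coord (dets w s) t ≡
    coord (λ i → + v i) s ℤ.* coord w t ℤ.- coord w s ℤ.* coord (λ i → + v i) t
  coord-dets w s (single i)    = ≡.refl
  coord-dets w s (plus i j _)  = solve 6 (λ a b x y x′ y′ →
    (a :* x :- b :* y) :+ (a :* x′ :- b :* y′) := a :* (x :+ x′) :- b :* (y :+ y′))
    ≡.refl (coord (λ i → + v i) s) (coord w s) (w i) (+ v i) (w j) (+ v j)
    where open ℤSolver
  coord-dets w s (minus i j _) = solve 6 (λ a b x y x′ y′ →
    (a :* x :- b :* y) :- (a :* x′ :- b :* y′) := a :* (x :- x′) :- b :* (y :- y′))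
    ≡.refl (coord (λ i → + v i) s) (coord w s) (w i) (+ v i) (w j) (+ v j)
    where open ℤSolver

  -- With the next two this is det(s, s) = 0, spelt out for the three kinds of position: a runner at
  -- rest, two opposite ones, two equal ones.
  dets-single : ∀ w b → dets w (single b) b ≡ 0ℤ
  dets-single w b = ≡.trans (cong (λ z → z ℤ.- w b ℤ.* + v b) (ℤ.*-comm (+ v b) (w b))) (ℤ.+-inverseʳ (w b ℤ.* + v b))

  dets-plus : ∀ w a b .(a<b : a Fin.< b) → dets w (plus a b a<b) b ≡ ℤ.- dets w (plus a b a<b) a
  dets-plus w a b _ = solve 4 (λ v v′ w w′ →
    (v :+ v′) :* w′ :- (w :+ w′) :* v′ := :- ((v :+ v′) :* w :- (w :+ w′) :* v))
    ≡.refl (+ v a) (+ v b) (w a) (w b)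
    where open ℤSolver

  dets-minus : ∀ w a b .(a<b : a Fin.< b) → dets w (minus a b a<b) a ≡ dets w (minus a b a<b) b
  dets-minus w a b _ = solve 4 (λ v v′ w w′ →
    (v :- v′) :* w :- (w :- w′) :* v := (v :- v′) :* w′ :- (w :- w′) :* v′)
    ≡.refl (+ v a) (+ v b) (w a) (w b)
    where open ℤSolver

module _ {k} (v : Vector ℕ k) (v>0 : ∀ i → 0 ℕ.< v i) (v-injective : Injective _≡_ _≡_ v) where

  coord-≢0 : ∀ s → coord (λ i → + v i) s ≢ 0ℤ
  coord-≢0 (single i)      eq = ℕ.<⇒≢ (v>0 i) (≡.sym (ℤ.+-injective eq))
  coord-≢0 (plus i j _)    eq = ℕ.<⇒≢ (ℕ.<-≤-trans (v>0 i) (ℕ.m≤m+n (v i) (v j)))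
                                  (≡.sym (ℤ.+-injective (≡.trans (ℤ.pos-+ (v i) (v j)) eq)))
  coord-≢0 (minus i j i<j) eq = ⊥-elim-irr (Fin.<⇒≢ i<j
    (v-injective (ℤ.+-injective (ℤ.i-j≡0⇒i≡j (+ v i) (+ v j) eq))))

  pair-admissible : (w : Vector ℤ k) → ¬ (∀ i j → + v i ℤ.* w j ≡ w i ℤ.* + v j) →
    Admissible (pair (λ i → + v i) w)
  pair-admissible w w∦v = record
    { nonZero        = λ i eq → coord-≢0 (single i) (/1-injective (cong proj₁ eq))
    ; notAllParallel = λ all → w∦v λ i j → parallel⁻¹ (+ v i) (w i) (+ v j) (w j) (all i j)
    ; notEqual       = λ i j i≢j eq → i≢j (v-injective (ℤ.+-injective (/1-injective (cong proj₁ eq))))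
    ; notOpposite    = λ i j i≢j eq → v+v≢0 i j (/1-injective (begin
        (+ v i ℤ.+ + v j) /1                ≡⟨ /1-+ (+ v i) (+ v j) ⟩
        + v i /1 ℚ.+ + v j /1               ≡⟨ cong (ℚ._+ + v j /1) (cong proj₁ eq) ⟩
        (0ℚ ℚ.- + v j /1) ℚ.+ + v j /1      ≡⟨ solve 1 (λ x → (con 0ℚ :- x) :+ x := con 0ℚ) ≡.refl (+ v j /1) ⟩
        0ℚ                                  ∎))
    }
    where
    open ≡.≡-Reasoning
    open ℚSolver
    v+v≢0 : ∀ i j → + v i ℤ.+ + v j ≢ 0ℤ
    v+v≢0 i j eq = ℕ.<⇒≢ (ℕ.<-≤-trans (v>0 i) (ℕ.m≤m+n (v i) (v j)))
                     (≡.sym (ℤ.+-injective (≡.trans (ℤ.pos-+ (v i) (v j)) eq)))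

  lonely-dets : (w : Vector ℤ k) (s : Position k) →
    (∀ t → t ≢ s → ¬ Parallel (S (pair (λ i → + v i) w) s) (S (pair (λ i → + v i) w) t)) →
    ∀ t → t ≢ s → coord (dets v w s) t ≢ 0ℤ
  lonely-dets w s lonely t t≢s eq = lonely t t≢s
    (≡.subst₂ Parallel (≡.sym (S-pair (λ i → + v i) w s)) (≡.sym (S-pair (λ i → + v i) w t))
      (parallel (coord (λ i → + v i) s) (coord w s) (coord (λ i → + v i) t) (coord w t) (coord-≢0 t)
        (ℤ.i-j≡0⇒i≡j _ _ (≡.trans (≡.sym (coord-dets v w s t)) eq))))

Last : ∀ {k} → Fin k → Position k → Set
Last b (single i)    = b ≡ i
Last b (plus i j _)  = b ≡ j
Last b (minus i j _) = b ≡ j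

record Velocities {m} (f : Vector ℤ m) : Set where
  field
    nonZero     : ∀ i → f i ≢ 0ℤ
    notEqual    : ∀ {i j} → i ≢ j → f i ≢ f j
    notOpposite : ∀ {i j} → i ≢ j → f i ≢ ℤ.- f j

-- A position that does not involve `b` is different from `s`, which does; so the sums and
-- differences of the remaining velocities are determinants known not to vanish.
removeAt-velocities : ∀ {m} (f : Vector ℤ (suc m)) (s : Position (suc m)) b → Last b s →
  (∀ t → t ≢ s → coord f t ≢ 0ℤ) → Velocities (f ∘ punchIn b)
removeAt-velocities f s b last≡b nonVanishing = record
  { nonZero     = λ i → nonVanishing (single (punchIn b i)) (≢s _ (Fin.punchInᵢ≢i b i ∘ ≡.sym))
  ; notEqual    = λ {i} {j} i≢j eq → notEqual (punchIn b i) (punchIn b j)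
                    (i≢j ∘ Fin.punchIn-injective b i j) (Fin.punchInᵢ≢i b i ∘ ≡.sym) (Fin.punchInᵢ≢i b j ∘ ≡.sym) eq
  ; notOpposite = λ {i} {j} i≢j eq → notOpposite (punchIn b i) (punchIn b j)
                    (i≢j ∘ Fin.punchIn-injective b i j) (Fin.punchInᵢ≢i b i ∘ ≡.sym) (Fin.punchInᵢ≢i b j ∘ ≡.sym)
                    (≡.trans (cong (ℤ._+ f (punchIn b j)) eq) (ℤ.+-inverseˡ (f (punchIn b j))))
  }
  where
  ≢s : ∀ t → ¬ Last b t → t ≢ s
  ≢s t ¬last ≡.refl = ¬last last≡b

  notEqual : ∀ i j → i ≢ j → b ≢ i → b ≢ j → f i ≢ f j
  notEqual i j i≢j b≢i b≢j eq with Fin.<-cmp i j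
  ... | tri< i<j _ _ = nonVanishing (minus i j i<j) (≢s _ b≢j) (ℤ.i≡j⇒i-j≡0 eq)
  ... | tri≈ _ i≡j _ = i≢j i≡j
  ... | tri> _ _ j<i = nonVanishing (minus j i j<i) (≢s _ b≢i) (ℤ.i≡j⇒i-j≡0 (≡.sym eq))

  notOpposite : ∀ i j → i ≢ j → b ≢ i → b ≢ j → f i ℤ.+ f j ≢ 0ℤ
  notOpposite i j i≢j b≢i b≢j eq with Fin.<-cmp i j
  ... | tri< i<j _ _ = nonVanishing (plus i j i<j) (≢s _ b≢j) eq
  ... | tri≈ _ i≡j _ = i≢j i≡j
  ... | tri> _ _ j<i = nonVanishing (plus j i j<i) (≢s _ b≢i) (≡.trans (ℤ.+-comm (f j) (f i)) eq)

-- Coprimality, binomial coefficients and the pigeonhole principle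

foldr-gcd-∣ : ∀ {m} (v : Vector ℕ m) i → foldr gcd 0 v ∣ v i
foldr-gcd-∣ v zero    = gcd[m,n]∣m (v zero) _
foldr-gcd-∣ v (suc i) = ∣-trans (gcd[m,n]∣n (v zero) _) (foldr-gcd-∣ (tail v) i)

bezout⇒coprime : ∀ {m} (b : Vector ℤ m) (v : Vector ℕ m) →
  Σᶻ (λ i → b i ℤ.* + v i) ≡ 1ℤ → foldr gcd 0 v ≡ 1
bezout⇒coprime b v eq = ℕ.m*n≡1⇒n≡1 ℤ.∣ Σᶻ q ∣ g (begin
  ℤ.∣ Σᶻ q ∣ ℕ.* g                         ≡⟨ ℤ.abs-* (Σᶻ q) (+ g) ⟨
  ℤ.∣ Σᶻ q ℤ.* + g ∣                       ≡⟨ cong ℤ.∣_∣ (∑ᶻ.*-distribʳ-sum (+ g) q) ⟩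
  ℤ.∣ Σᶻ (λ i → q i ℤ.* + g) ∣             ≡⟨ cong ℤ.∣_∣ (∑ᶻ.sum-cong-≗ λ i →
    ≡.trans (ℤ.*-assoc (b i) _ (+ g)) (cong (b i ℤ.*_) (≡.sym (v≡ i)))) ⟩
  ℤ.∣ Σᶻ (λ i → b i ℤ.* + v i) ∣           ≡⟨ cong ℤ.∣_∣ eq ⟩
  1                                        ∎)
  where
  open ≡.≡-Reasoning
  g = foldr gcd 0 v
  q : Vector ℤ _
  q i = b i ℤ.* + quotient (foldr-gcd-∣ v i)
  v≡ : ∀ i → + v i ≡ + quotient (foldr-gcd-∣ v i) ℤ.* + g
  v≡ i = ≡.trans (cong +_ (_∣_.equality (foldr-gcd-∣ v i))) (ℤ.pos-* (quotient (foldr-gcd-∣ v i)) g)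

2*[1+n]C2≡n*[1+n] : ∀ n → 2 ℕ.* (suc n C 2) ≡ n ℕ.* suc n
2*[1+n]C2≡n*[1+n] zero    = ≡.refl
2*[1+n]C2≡n*[1+n] (suc n) = begin
  2 ℕ.* (suc (suc n) C 2)                  ≡⟨ cong (2 ℕ.*_) (nCk+nC[k+1]≡[n+1]C[k+1] (suc n) 1) ⟨
  2 ℕ.* (suc n C 1 ℕ.+ suc n C 2)          ≡⟨ ℕ.*-distribˡ-+ 2 (suc n C 1) (suc n C 2) ⟩
  2 ℕ.* (suc n C 1) ℕ.+ 2 ℕ.* (suc n C 2)  ≡⟨ cong₂ (λ x y → 2 ℕ.* x ℕ.+ y) (nC1≡n (suc n)) (2*[1+n]C2≡n*[1+n] n) ⟩
  2 ℕ.* suc n ℕ.+ n ℕ.* suc n              ≡⟨ ℕ.*-distribʳ-+ (suc n) 2 n ⟨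
  suc (suc n) ℕ.* suc n                    ≡⟨ ℕ.*-comm (suc (suc n)) (suc n) ⟩
  suc n ℕ.* suc (suc n)                    ∎
  where open ≡.≡-Reasoning

-- The residues of a point form one of N^d vectors, which `funToFin` numbers. For two points with
-- equal residues, `W` is the difference of the quotients.
congruent-pair : ∀ N .{{_ : ℕ.NonZero N}} {d k} (p : Vector (Vector ℤ d) k) → N ^ d ℕ.< k →
  Σ[ a ∈ Fin k ] Σ[ b ∈ Fin k ] a ≢ b × Σ[ W ∈ Vector ℤ d ] (∀ j → p a j ≡ p b j ℤ.+ + N ℤ.* W j)
congruent-pair N {d} {k} p N^d<k = a , b , Fin.<⇒≢ a<b , W , λ j → begin
  p a j
    ≡⟨ a≡a%ℕn+[a/ℕn]*n (p a j) N ⟩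
  + (p a j %ℕ N) ℤ.+ (p a j /ℕ N) ℤ.* + N
    ≡⟨ cong (λ r → + r ℤ.+ (p a j /ℕ N) ℤ.* + N) (same-residue j) ⟩
  + (p b j %ℕ N) ℤ.+ (p a j /ℕ N) ℤ.* + N
    ≡⟨ solve 4 (λ r x y n → r :+ x :* n := (r :+ y :* n) :+ n :* (x :- y)) ≡.refl
         (+ (p b j %ℕ N)) (p a j /ℕ N) (p b j /ℕ N) (+ N) ⟩
  (+ (p b j %ℕ N) ℤ.+ (p b j /ℕ N) ℤ.* + N) ℤ.+ + N ℤ.* W j
    ≡⟨ cong (λ z → z ℤ.+ + N ℤ.* W j) (a≡a%ℕn+[a/ℕn]*n (p b j) N) ⟨
  p b j ℤ.+ + N ℤ.* W j ∎
  where
  open ≡.≡-Reasoning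
  open ℤSolver
  residue : Fin k → Fin d → Fin N
  residue i j = fromℕ< (n%ℕd<d (p i j) N)
  pigeons = Fin.pigeonhole N^d<k (λ i → funToFin (residue i))
  a   = proj₁ pigeons
  b   = proj₁ (proj₂ pigeons)
  a<b = proj₁ (proj₂ (proj₂ pigeons))
  W : Vector ℤ d
  W j = (p a j /ℕ N) ℤ.- (p b j /ℕ N)
  same-residue : ∀ j → p a j %ℕ N ≡ p b j %ℕ N
  same-residue j = Fin.fromℕ<-injective (p a j %ℕ N) (p b j %ℕ N) _ _
    (≡.trans (≡.sym (Fin.finToFun-funToFin (residue a) j))
      (≡.trans (cong (λ f → finToFun f j) (proj₂ (proj₂ (proj₂ pigeons)))) (Fin.finToFun-funToFin (residue b) j)))

∣i∣≡∣j∣⇒i≡j⊎i≡-j : ∀ i j → ℤ.∣ i ∣ ≡ ℤ.∣ j ∣ → i ≡ j ⊎ i ≡ ℤ.- j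
∣i∣≡∣j∣⇒i≡j⊎i≡-j (+ m)      (+ n)      eq      = inj₁ (cong +_ eq)
∣i∣≡∣j∣⇒i≡j⊎i≡-j (+ m)      ℤ.-[1+ n ] eq      = inj₂ (cong +_ eq)
∣i∣≡∣j∣⇒i≡j⊎i≡-j ℤ.-[1+ m ] (+ n)      ≡.refl  = inj₂ ≡.refl
∣i∣≡∣j∣⇒i≡j⊎i≡-j ℤ.-[1+ m ] ℤ.-[1+ n ] ≡.refl  = inj₁ ≡.refl

∀-punchIn : ∀ {m} (P : Fin (suc m) → Set) b → (∀ j → P (punchIn b j)) → ∀ i → b ≢ i → P i
∀-punchIn P b Pj i b≢i = subst P (Fin.punchIn-punchOut b≢i) (Pj (punchOut b≢i))

∀-insertAt : ∀ {m} (P : Fin m → Set) b → P b → (∀ i → b ≢ i → P i) → ∀ i → P i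
∀-insertAt P b Pb Pi i with b Fin.≟ i
... | yes ≡.refl = Pb
... | no  b≢i    = Pi i b≢i

unitVector : ∀ {m} → Fin m → Vector ℤ m
unitVector zero    = 1ℤ ∷ λ _ → 0ℤ
unitVector (suc k) = 0ℤ ∷ unitVector k

-- Zonotopes, runners and coverings

module OrderedℚAlgebraProperties (A : OrderedℚAlgebra) where

  open OrderedℚAlgebra A
  open ℚ-AlgebraProperties algebra
  open Algebra.Properties.Ring ring using (+-cancelʳ)
  open Relation.Binary.Reasoning.Setoid setoid

  ⟪⟫-inverse : ∀ {z} → z ≢ 0ℤ → ∃[ e ] ⟪ z ⟫ * e ≈ 1#
  ⟪⟫-inverse {z} z≢0 with q , zq≡1 ← /1-inverse z≢0 = ι q , (begin
    ⟪ z ⟫ * ι q       ≈⟨ ι-* (z /1) q ⟨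
    ι (z /1 ℚ.* q)    ≡⟨ cong ι zq≡1 ⟩
    ι 1ℚ              ≈⟨ ι-1 ⟩
    1#                ∎)

  sum-+-* : ∀ {n} (f g w : Vector Carrier n) →
    sum (λ i → (f i + g i) * w i) ≈ sum (λ i → f i * w i) + sum (λ i → g i * w i)
  sum-+-* f g w = trans (sum-cong (λ i → distribʳ (w i) (f i) (g i)))
    (∑.∑-distrib-+ (λ i → f i * w i) (λ i → g i * w i))

  sum-scale-* : ∀ {n} c (f w : Vector Carrier n) →
    sum (λ i → (c * f i) * w i) ≈ c * sum (λ i → f i * w i)
  sum-scale-* c f w = trans (sum-cong (λ i → *-assoc c (f i) (w i)))
    (sym (∑.*-distribˡ-sum c (λ i → f i * w i)))

  sum-⟪⟫-* : ∀ {n} (f w : Vector ℤ n) → sum (λ i → ⟪ f i ⟫ * ⟪ w i ⟫) ≈ ⟪ Σᶻ (λ i → f i ℤ.* w i) ⟫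
  sum-⟪⟫-* f w = trans (sum-cong (λ i → sym (⟪⟫-* (f i) (w i)))) (sym (⟪⟫-sum (λ i → f i ℤ.* w i)))

  sum-unitVector : ∀ {m} (x : Vector Carrier m) j → sum (λ k → x k * ⟪ unitVector k j ⟫) ≈ x j
  sum-unitVector {suc m} x zero = begin
    x zero * ι 1ℚ + sum (λ k → x (suc k) * ι 0ℚ)   ≈⟨ +-cong (trans (*-congˡ ι-1) (*-identityʳ (x zero)))
                                                      (sum-cong (λ k → trans (*-congˡ ι-0) (zeroʳ (x (suc k))))) ⟩
    x zero + sum {m} (λ _ → 0#)                    ≈⟨ +-congˡ (∑.sum-replicate-zero m) ⟩
    x zero + 0#                                    ≈⟨ +-identityʳ (x zero) ⟩
    x zero                                         ∎
  sum-unitVector x (suc j) = begin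
    x zero * ι 0ℚ + sum (λ k → x (suc k) * ⟪ unitVector k j ⟫)
      ≈⟨ +-cong (trans (*-congˡ ι-0) (zeroʳ (x zero))) (sum-unitVector (tail x) j) ⟩
    0# + x (suc j)
      ≈⟨ +-identityˡ (x (suc j)) ⟩
    x (suc j) ∎

  -- Integer coefficients of the unit vectors extend linearly. The resulting `X` will be the
  -- starting positions of the runners.
  lift-generates : ∀ {m d} (u : Vector (Vector ℤ d) m) → Generates u → (x : Vector Carrier d) →
    Σ[ X ∈ Vector Carrier m ] (∀ j → x j ≈ sum (λ i → X i * ⟪ u i j ⟫))
  lift-generates {m} {d} u gen x = (λ i → sum (λ k → x k * ⟪ c k i ⟫)) , λ j → begin
    x j
      ≈⟨ sum-unitVector x j ⟨
    sum (λ k → x k * ⟪ unitVector k j ⟫)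
      ≈⟨ sum-cong (λ k → *-congˡ (trans (reflexive (cong ⟪_⟫ (proj₂ (gen (unitVector k)) j)))
           (sym (sum-⟪⟫-* (c k) (λ i → u i j))))) ⟩
    sum (λ k → x k * sum (λ i → ⟪ c k i ⟫ * ⟪ u i j ⟫))
      ≈⟨ sum-cong (λ k → trans (∑.*-distribˡ-sum (x k) (λ i → ⟪ c k i ⟫ * ⟪ u i j ⟫))
           (sum-cong (λ i → sym (*-assoc (x k) ⟪ c k i ⟫ ⟪ u i j ⟫)))) ⟩
    sum (λ k → sum (λ i → (x k * ⟪ c k i ⟫) * ⟪ u i j ⟫))
      ≈⟨ ∑.∑-comm (λ k i → (x k * ⟪ c k i ⟫) * ⟪ u i j ⟫) ⟩
    sum (λ i → sum (λ k → (x k * ⟪ c k i ⟫) * ⟪ u i j ⟫))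
      ≈⟨ sum-cong (λ i → sym (∑.*-distribʳ-sum ⟪ u i j ⟫ (λ k → x k * ⟪ c k i ⟫))) ⟩
    sum (λ i → sum (λ k → x k * ⟪ c k i ⟫) * ⟪ u i j ⟫) ∎
    where
    c : Fin d → Vector ℤ m
    c k = proj₁ (gen (unitVector k))

  InBox : ℚ → Carrier → Set
  InBox ρ t = NonNegative t × NonNegative (ι ρ - t)

  -- ρZ + ℤᵈ is the whole space, for Z the zonotope of u.
  ZonotopeCovers : ∀ {m d} → ℚ → Vector (Vector ℤ d) m → Set
  ZonotopeCovers {m} {d} ρ u = (x : Vector Carrier d) →
    Σ[ t ∈ Vector Carrier m ] Σ[ z ∈ Vector ℤ d ]
      (∀ i → InBox ρ (t i)) × (∀ j → x j ≈ sum (λ i → t i * ⟪ u i j ⟫) + ⟪ z j ⟫)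

  combination : ∀ {m d} → Vector (Vector ℤ d) m → Vector Carrier m → Vector Carrier d
  combination u t j = sum (λ i → t i * ⟪ u i j ⟫)

  sum≈combination : ∀ {m d} (u : Vector (Vector ℤ d) m) (t : Vector Carrier m) j (f : Vector Carrier m) →
    (∀ i → f i ≈ t i * ⟪ u i j ⟫) → sum f ≈ combination u t j
  sum≈combination u t j f = sum-cong

  InZonotope : ∀ {m d} → Vector (Vector ℤ d) m → Vector Carrier d → Set
  InZonotope {m} u y = Σ[ t ∈ Vector Carrier m ] (∀ i → InBox 1ℚ (t i)) × (∀ j → y j ≈ combination u t j)

  -- Here the dilation factor multiplies the point, as in `Covers`. In `ZonotopeCovers` it bounds
  -- the coefficients, so that factors add up when coefficients do, and the factor 0 is allowed.
  ScaledZonotopeCovers : ∀ {m d} → Carrier → Vector (Vector ℤ d) m → Set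
  ScaledZonotopeCovers {m} {d} μ u = (x : Vector Carrier d) →
    Σ[ y ∈ Vector Carrier d ] Σ[ z ∈ Vector ℤ d ] InZonotope u y × (∀ j → x j ≈ μ * y j + ⟪ z j ⟫)

  -- The unit box is scaled towards its corner 0, so a smaller factor gives a smaller box: ρ - μt =
  -- (ρ - μ) + μ(1 - t).
  scaled⇒zonotopeCovers : ∀ {m d} {ρ μ} (u : Vector (Vector ℤ d) m) → InBox ρ μ →
    ScaledZonotopeCovers μ u → ZonotopeCovers ρ u
  scaled⇒zonotopeCovers {ρ = ρ} {μ} u (μ≥0 , μ≤ρ) cov x with y , z , (t , box , y≈) , x≈ ← cov x =
    (λ i → μ * t i) , z
    , (λ i → nonNeg-* μ≥0 (proj₁ (box i))
           , nonNeg-resp (solve 3 (λ ρ μ t → (ρ :- μ) :+ μ :* (con 1ℤ :- t) := ρ :- μ :* t) refl (ι ρ) μ (t i))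
               (nonNeg-+ μ≤ρ (nonNeg-* μ≥0 (proj₂ (box i)))))
    , λ j → trans (x≈ j) (+-congʳ (trans (*-congˡ (y≈ j)) (sym (sum-scale-* μ t (λ i → ⟪ u i j ⟫)))))

  zonotopeCovers⇒scaled : ∀ {m d} ρ κ μ (u : Vector (Vector ℤ d) m) → 0ℚ ℚ.≤ κ → ρ ℚ.* κ ≡ 1ℚ → μ ≈ ι ρ →
    ZonotopeCovers ρ u → ScaledZonotopeCovers μ u
  zonotopeCovers⇒scaled ρ κ μ u κ≥0 ρκ≡1 μ≈ρ cov x with t , z , box , x≈ ← cov x =
    (λ j → sum (λ i → (ι κ * t i) * ⟪ u i j ⟫)) , z
    , ((λ i → ι κ * t i)
      , (λ i → nonNeg-* (nonNeg-ι κ≥0) (proj₁ (box i))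
             , nonNeg-resp (begin
                 ι κ * (ι ρ - t i)          ≈⟨ solve 3 (λ κ ρ t → κ :* (ρ :- t) := ρ :* κ :- κ :* t) refl (ι κ) (ι ρ) (t i) ⟩
                 ι ρ * ι κ - ι κ * t i      ≈⟨ +-congʳ (trans (sym (ι-* ρ κ)) (reflexive (cong ι ρκ≡1))) ⟩
                 ι 1ℚ - ι κ * t i           ∎)
                 (nonNeg-* (nonNeg-ι κ≥0) (proj₂ (box i))))
      , λ j → refl)
    , λ j → trans (x≈ j) (+-congʳ (begin
        sum (λ i → t i * ⟪ u i j ⟫)
          ≈⟨ *-identityˡ _ ⟨
        1# * sum (λ i → t i * ⟪ u i j ⟫)
          ≈⟨ *-congʳ (trans (sym ι-1) (trans (reflexive (cong ι (≡.sym ρκ≡1))) (ι-* ρ κ))) ⟩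
        (ι ρ * ι κ) * sum (λ i → t i * ⟪ u i j ⟫)
          ≈⟨ *-assoc (ι ρ) (ι κ) _ ⟩
        ι ρ * (ι κ * sum (λ i → t i * ⟪ u i j ⟫))
          ≈⟨ *-cong (sym μ≈ρ) (sym (sum-scale-* (ι κ) t (λ i → ⟪ u i j ⟫))) ⟩
        μ * sum (λ i → (ι κ * t i) * ⟪ u i j ⟫) ∎))

  -- A runner at x is at distance at most ρ to the right of the integers.
  Within : ℚ → Carrier → Set
  Within ρ x = Σ[ t ∈ Carrier ] Σ[ c ∈ ℤ ] InBox ρ t × x ≈ t + ⟪ c ⟫

  within-resp : ∀ {ρ x y} → x ≈ y → Within ρ x → Within ρ y
  within-resp x≈y (t , c , box , eq) = t , c , box , trans (sym x≈y) eq

  -- The set [0, ρ] + ℤ is invariant under x ↦ ρ - x. Mirror images of runners therefore add up to ρ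
  -- and not to 0.
  within-reflect : ∀ {ρ x y} → x + y ≈ ι ρ → Within ρ x → Within ρ y
  within-reflect {ρ} {x} {y} x+y≈ρ (t , c , (t≥0 , t≤ρ) , eq) = ι ρ - t , ℤ.- c
    , (t≤ρ , nonNeg-resp (solve 2 (λ ρ t → t := ρ :- (ρ :- t)) refl (ι ρ) t) t≥0)
    , (begin
      y                      ≈⟨ solve 2 (λ x y → y := (x :+ y) :- x) refl x y ⟩
      (x + y) - x            ≈⟨ +-cong x+y≈ρ (-‿cong eq) ⟩
      ι ρ - (t + ⟪ c ⟫)      ≈⟨ solve 3 (λ ρ t c → ρ :- (t :+ c) := (ρ :- t) :+ (:- c)) refl (ι ρ) t ⟪ c ⟫ ⟩
      (ι ρ - t) + - ⟪ c ⟫    ≈⟨ +-congˡ (⟪⟫-neg c) ⟨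
      (ι ρ - t) + ⟪ ℤ.- c ⟫  ∎)

  within-0 : ∀ {ρ} → 0ℚ ℚ.≤ ρ → Within ρ 0#
  within-0 {ρ} 0≤ρ = 0# , 0ℤ , (nonNeg-resp ι-0 (nonNeg-ι ℚ.≤-refl)
    , nonNeg-resp (trans (solve 1 (λ ρ → ρ := ρ :- con 0ℤ) refl (ι ρ)) (+-congˡ (-‿cong ι-0))) (nonNeg-ι 0≤ρ))
    , sym (trans (+-identityˡ ⟪ 0ℤ ⟫) ι-0)

  -- At some time σ, all runners started at X with velocities f are within ρ.
  ShiftedLonely : ∀ {m} → ℚ → Vector ℤ m → Set
  ShiftedLonely {m} ρ f = (X : Vector Carrier m) → ∃[ σ ] ∀ i → Within ρ (X i - σ * ⟪ f i ⟫)

  module _ {d} {ρ : ℚ} (0≤ρ : 0ℚ ℚ.≤ ρ)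
    (conjectureC : (v : Vector ℕ (suc d)) (u : Vector (Vector ℤ d) (suc d)) → IsSLRZ v u → ZonotopeCovers ρ u)
    where

    -- The generators `u` forget the time: `X` is sent to a point `x`, covering `x` yields
    -- coefficients t + c with the same image, and by `kernel` the difference from `X` is σr.
    -- Passing from `r` to v = gr rescales time by 1/g.
    shiftedLonely-ℕ : (v : Vector ℕ (suc d)) → (∀ i → 0 ℕ.< v i) → Injective _≡_ _≡_ v →
      ShiftedLonely ρ (λ i → + v i)
    shiftedLonely-ℕ v v>0 v-injective X
      with g , r , v≡gr , D , kernel ← primitiveMultiple v v>0 = σ * e , λ i →
        t i , c i , box i , (begin
          X i - (σ * e) * ⟪ + v i ⟫
            ≈⟨ +-cong (X≈ i) (-‿cong (begin
                 (σ * e) * ⟪ + v i ⟫             ≈⟨ *-congˡ (trans (reflexive (cong ⟪_⟫ (≡.trans (cong +_ (v≡gr i)) (ℤ.pos-* g (r i)))))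
                                                      (⟪⟫-* (+ g) (+ r i))) ⟩
                 (σ * e) * (⟪ + g ⟫ * ⟪ + r i ⟫) ≈⟨ solve 4 (λ σ e g r → (σ :* e) :* (g :* r) := (g :* e) :* (σ :* r))
                                                      refl σ e ⟪ + g ⟫ ⟪ + r i ⟫ ⟩
                 (⟪ + g ⟫ * e) * (σ * ⟪ + r i ⟫) ≈⟨ *-congʳ ge≈1 ⟩
                 1# * (σ * ⟪ + r i ⟫)            ≈⟨ *-identityˡ _ ⟩
                 σ * ⟪ + r i ⟫                   ≈⟨ y≈σr i ⟨
                 y i                             ∎)) ⟩
          (y i + (t i + ⟪ c i ⟫)) - y i
            ≈⟨ solve 2 (λ y s → (y :+ s) :- y := s) refl (y i) (t i + ⟪ c i ⟫) ⟩
          t i + ⟪ c i ⟫ ∎)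
      where
      open Dual D

      g≢0 : + g ≢ 0ℤ
      g≢0 eq = ℕ.<⇒≢ (v>0 zero) (≡.sym (≡.trans (v≡gr zero) (cong (ℕ._* r zero) (ℤ.+-injective eq))))

      e    = proj₁ (⟪⟫-inverse g≢0)
      ge≈1 = proj₂ (⟪⟫-inverse g≢0)

      slrz : IsSLRZ r u
      slrz = record
        { positive  = λ i → ℕ.n≢0⇒n>0 λ r≡0 →
            ℕ.<⇒≢ (v>0 i) (≡.sym (≡.trans (v≡gr i) (≡.trans (cong (g ℕ.*_) r≡0) (ℕ.*-zeroʳ g))))
        ; coprime   = bezout⇒coprime b r bezout
        ; distinct  = λ {i} {j} eq → v-injective (≡.trans (v≡gr i) (≡.trans (cong (g ℕ.*_) eq) (≡.sym (v≡gr j))))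
        ; generates = generates
        ; relation  = relation
        }

      x : Vector Carrier d
      x j = sum (λ i → X i * ⟪ u i j ⟫)

      cover = conjectureC r u slrz x
      t     = proj₁ cover
      z     = proj₁ (proj₂ cover)
      box   = proj₁ (proj₂ (proj₂ cover))
      x≈    = proj₂ (proj₂ (proj₂ cover))
      c     = proj₁ (generates z)

      y : Vector Carrier (suc d)
      y i = X i - (t i + ⟪ c i ⟫)

      X≈ : ∀ i → X i ≈ y i + (t i + ⟪ c i ⟫)
      X≈ i = solve 2 (λ x s → x := (x :- s) :+ s) refl (X i) (t i + ⟪ c i ⟫)

      ker : ∀ j → sum (λ i → y i * ⟪ u i j ⟫) ≈ 0#
      ker j = +-cancelʳ (x j) _ 0# (begin
        sum (λ i → y i * ⟪ u i j ⟫) + x j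
          ≈⟨ +-congˡ (begin
               x j
                 ≈⟨ x≈ j ⟩
               sum (λ i → t i * ⟪ u i j ⟫) + ⟪ z j ⟫
                 ≈⟨ +-congˡ (trans (reflexive (cong ⟪_⟫ (proj₂ (generates z) j))) (sym (sum-⟪⟫-* c (λ i → u i j)))) ⟩
               sum (λ i → t i * ⟪ u i j ⟫) + sum (λ i → ⟪ c i ⟫ * ⟪ u i j ⟫)
                 ≈⟨ sum-+-* t (λ i → ⟪ c i ⟫) (λ i → ⟪ u i j ⟫) ⟨
               sum (λ i → (t i + ⟪ c i ⟫) * ⟪ u i j ⟫) ∎) ⟩
        sum (λ i → y i * ⟪ u i j ⟫) + sum (λ i → (t i + ⟪ c i ⟫) * ⟪ u i j ⟫)
          ≈⟨ sum-+-* y (λ i → t i + ⟪ c i ⟫) (λ i → ⟪ u i j ⟫) ⟨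
        sum (λ i → (y i + (t i + ⟪ c i ⟫)) * ⟪ u i j ⟫)
          ≈⟨ sum-cong (λ i → *-congʳ {⟪ u i j ⟫} (X≈ i)) ⟨
        x j
          ≈⟨ +-identityˡ (x j) ⟨
        0# + x j ∎)

      σ    = proj₁ (kernel y ker)
      y≈σr = proj₂ (kernel y ker)

    -- A runner with negative velocity is replaced by its mirror image.
    reflect : ∀ x z → Σ[ x′ ∈ Carrier ] (∀ σ → Within ρ (x′ - σ * ⟪ + ℤ.∣ z ∣ ⟫) → Within ρ (x - σ * ⟪ z ⟫))
    reflect x z with ℤ.+∣i∣≡i⊎+∣i∣≡-i z
    ... | inj₁ eq = x , λ σ → within-resp (+-congˡ (-‿cong (*-congˡ (reflexive (cong ⟪_⟫ eq)))))
    ... | inj₂ eq = ι ρ - x , λ σ → within-reflect (begin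
      ((ι ρ - x) - σ * ⟪ + ℤ.∣ z ∣ ⟫) + (x - σ * ⟪ z ⟫)
        ≈⟨ +-congʳ (+-congˡ (-‿cong (*-congˡ (trans (reflexive (cong ⟪_⟫ eq)) (⟪⟫-neg z))))) ⟩
      ((ι ρ - x) - σ * - ⟪ z ⟫) + (x - σ * ⟪ z ⟫)
        ≈⟨ solve 4 (λ ρ x σ f → ((ρ :- x) :- σ :* (:- f)) :+ (x :- σ :* f) := ρ) refl (ι ρ) x σ ⟪ z ⟫ ⟩
      ι ρ ∎)

    shiftedLonely-ℤ : (f : Vector ℤ (suc d)) → Velocities f → ShiftedLonely ρ f
    shiftedLonely-ℤ f f-velocities X =
      proj₁ run , λ i → proj₂ (reflect (X i) (f i)) (proj₁ run) (proj₂ run i)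
      where
      open Velocities f-velocities

      ∣f∣-injective : Injective _≡_ _≡_ (λ i → ℤ.∣ f i ∣)
      ∣f∣-injective {i} {j} eq with i Fin.≟ j
      ... | yes i≡j = i≡j
      ... | no  i≢j with ∣i∣≡∣j∣⇒i≡j⊎i≡-j (f i) (f j) eq
      ...   | inj₁ e = ⊥-elim (notEqual i≢j e)
      ...   | inj₂ e = ⊥-elim (notOpposite i≢j e)

      run = shiftedLonely-ℕ (λ i → ℤ.∣ f i ∣) (λ i → ℕ.n≢0⇒n>0 (nonZero i ∘ ℤ.∣i∣≡0⇒i≡0)) ∣f∣-injective
              (λ i → proj₁ (reflect (X i) (f i)))

    shiftedLonely-insertAt : (f : Vector ℤ (suc (suc d))) (X : Vector Carrier (suc (suc d))) (b : Fin (suc (suc d))) →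
      Velocities (f ∘ punchIn b) →
      (∀ σ → (∀ i → b ≢ i → Within ρ (X i - σ * ⟪ f i ⟫)) → Within ρ (X b - σ * ⟪ f b ⟫)) →
      ∃[ σ ] ∀ i → Within ρ (X i - σ * ⟪ f i ⟫)
    shiftedLonely-insertAt f X b f-velocities tied =
      proj₁ run , ∀-insertAt _ b (tied (proj₁ run) (∀-punchIn _ b (proj₂ run))) (∀-punchIn _ b (proj₂ run))
      where
      run = shiftedLonely-ℤ (f ∘ punchIn b) f-velocities (X ∘ punchIn b)

    module _ (v : Vector ℕ (suc (suc d))) (v>0 : ∀ i → 0 ℕ.< v i) (v-injective : Injective _≡_ _≡_ v)
      (w : Vector ℤ (suc (suc d))) (X : Vector Carrier (suc (suc d))) where

      vᶻ : Vector ℤ (suc (suc d))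
      vᶻ i = + v i

      det : Position (suc (suc d)) → Vector ℤ (suc (suc d))
      det = dets v w

      -- The coefficient of `μ` is the value at v of the linear form belonging to `s`, non-zero for
      -- positive distinct velocities. Hence a shift along v can give that form any prescribed value
      -- on the starting positions.
      divide : ∀ s y → ∃[ μ ] μ * ⟪ coord vᶻ s ⟫ ≈ y
      divide s y = y * proj₁ inv , (begin
        (y * proj₁ inv) * D  ≈⟨ *-assoc y (proj₁ inv) D ⟩
        y * (proj₁ inv * D)  ≈⟨ *-congˡ (trans (*-comm (proj₁ inv) D) (proj₂ inv)) ⟩
        y * 1#               ≈⟨ *-identityʳ y ⟩
        y                    ∎)
        where
        D   = ⟪ coord vᶻ s ⟫
        inv = ⟪⟫-inverse (coord-≢0 v v>0 v-injective s)

      Tied : Position (suc (suc d)) → Set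
      Tied s = Σ[ b ∈ Fin (suc (suc d)) ] Last b s × ∃[ μ ] ∀ σ →
        let runner = λ i → (X i - μ * ⟪ + v i ⟫) - σ * ⟪ det s i ⟫ in
        (∀ i → b ≢ i → Within ρ (runner i)) → Within ρ (runner b)

      -- Moving X along v, which is invisible to the zonotope, makes the last
      -- runner b of s stand still at 0, or run with another one, or run
      -- opposite to it.
      tied : ∀ s → Tied s
      tied s@(single b) = b , ≡.refl , μ , λ σ _ → within-resp (sym (begin
        (X b - μ * ⟪ + v b ⟫) - σ * ⟪ det s b ⟫
          ≈⟨ +-cong (+-congˡ (-‿cong μ≈)) (-‿cong (*-congˡ (trans (reflexive (cong ⟪_⟫ (dets-single v w b))) ι-0))) ⟩
        (X b - X b) - σ * 0#
          ≈⟨ +-cong (-‿inverseʳ (X b)) (-‿cong (zeroʳ σ)) ⟩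
        0# - 0#
          ≈⟨ -‿inverseʳ 0# ⟩
        0# ∎)) (within-0 0≤ρ)
        where
        μ  = proj₁ (divide s (X b))
        μ≈ = proj₂ (divide s (X b))
      tied s@(plus a b a<b) = b , ≡.refl , μ , λ σ within →
        within-reflect (begin
          ((X a - μ * ⟪ + v a ⟫) - σ * ⟪ det s a ⟫) + ((X b - μ * ⟪ + v b ⟫) - σ * ⟪ det s b ⟫)
            ≈⟨ +-congˡ (+-congˡ (-‿cong (*-congˡ (trans (reflexive (cong ⟪_⟫ (dets-plus v w a b a<b))) (⟪⟫-neg (det s a)))))) ⟩
          ((X a - μ * ⟪ + v a ⟫) - σ * ⟪ det s a ⟫) + ((X b - μ * ⟪ + v b ⟫) - σ * - ⟪ det s a ⟫)
            ≈⟨ solve 7 (λ x m v s f y v′ → ((x :- m :* v) :- s :* f) :+ ((y :- m :* v′) :- s :* (:- f)) :=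
                 (x :+ y) :- m :* (v :+ v′)) refl (X a) μ ⟪ + v a ⟫ σ ⟪ det s a ⟫ (X b) ⟪ + v b ⟫ ⟩
          (X a + X b) - μ * (⟪ + v a ⟫ + ⟪ + v b ⟫)
            ≈⟨ +-congˡ (-‿cong (trans (*-congˡ (sym (⟪⟫-+ (+ v a) (+ v b)))) μ≈)) ⟩
          (X a + X b) - ((X a + X b) - ι ρ)
            ≈⟨ solve 2 (λ x r → x :- (x :- r) := r) refl (X a + X b) (ι ρ) ⟩
          ι ρ ∎)
        (within a b≢a)
        where
        -- The two runners are to be mirror images under x ↦ ρ - x, hence the target value ρ for the
        -- sum of their positions.
        μ  = proj₁ (divide s ((X a + X b) - ι ρ))
        μ≈ = proj₂ (divide s ((X a + X b) - ι ρ))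
        b≢a : b ≢ a
        b≢a b≡a = ⊥-elim-irr (Fin.<⇒≢ a<b (≡.sym b≡a))
      tied s@(minus a b a<b) = b , ≡.refl , μ , λ σ within →
        within-resp (begin
          (X a - μ * ⟪ + v a ⟫) - σ * ⟪ det s a ⟫
            ≈⟨ solve 6 (λ x m v f y v′ → (x :- m :* v) :- f :=
                 ((y :- m :* v′) :- f) :+ ((x :- y) :- m :* (v :- v′))) refl (X a) μ ⟪ + v a ⟫ (σ * ⟪ det s a ⟫) (X b) ⟪ + v b ⟫ ⟩
          ((X b - μ * ⟪ + v b ⟫) - σ * ⟪ det s a ⟫) + ((X a - X b) - μ * (⟪ + v a ⟫ - ⟪ + v b ⟫))
            ≈⟨ +-cong (+-congˡ (-‿cong (*-congˡ (reflexive (cong ⟪_⟫ (dets-minus v w a b a<b)))))) (+-congˡ (-‿cong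
                 (trans (*-congˡ (sym (trans (⟪⟫-+ (+ v a) (ℤ.- + v b)) (+-congˡ (⟪⟫-neg (+ v b)))))) μ≈))) ⟩
          ((X b - μ * ⟪ + v b ⟫) - σ * ⟪ det s b ⟫) + ((X a - X b) - (X a - X b))
            ≈⟨ trans (+-congˡ (-‿inverseʳ (X a - X b))) (+-identityʳ _) ⟩
          (X b - μ * ⟪ + v b ⟫) - σ * ⟪ det s b ⟫ ∎)
        (within a b≢a)
        where
        μ  = proj₁ (divide s (X a - X b))
        μ≈ = proj₂ (divide s (X a - X b))
        b≢a : b ≢ a
        b≢a b≡a = ⊥-elim-irr (Fin.<⇒≢ a<b (≡.sym b≡a))

      -- The velocity det(s, pᵢ) is s₁wᵢ - s₂vᵢ, so running for the time σ means a displacement by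
      -- σs₁ along w and by -σs₂ along v, to which the preparatory shift `μ` along v is added.
      shiftedLonely-plane : LonelyVectorProperty (suc (suc d)) →
        ¬ (∀ i j → + v i ℤ.* w j ≡ w i ℤ.* + v j) →
        ∃[ σ ] ∃[ μ ] ∀ i → Within ρ (X i - (σ * ⟪ w i ⟫ + μ * ⟪ + v i ⟫))
      shiftedLonely-plane lvp w∦v = σ * ⟪ coord vᶻ s ⟫ , μ - σ * ⟪ coord w s ⟫ , λ i →
        within-resp (begin
          (X i - μ * ⟪ + v i ⟫) - σ * ⟪ det s i ⟫
            ≈⟨ +-congˡ (-‿cong (*-congˡ (begin
                 ⟪ coord vᶻ s ℤ.* w i ℤ.- coord w s ℤ.* + v i ⟫
                   ≈⟨ ⟪⟫-+ (coord vᶻ s ℤ.* w i) (ℤ.- (coord w s ℤ.* + v i)) ⟩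
                 ⟪ coord vᶻ s ℤ.* w i ⟫ + ⟪ ℤ.- (coord w s ℤ.* + v i) ⟫
                   ≈⟨ +-cong (⟪⟫-* (coord vᶻ s) (w i)) (trans (⟪⟫-neg (coord w s ℤ.* + v i)) (-‿cong (⟪⟫-* (coord w s) (+ v i)))) ⟩
                 ⟪ coord vᶻ s ⟫ * ⟪ w i ⟫ - ⟪ coord w s ⟫ * ⟪ + v i ⟫ ∎))) ⟩
          (X i - μ * ⟪ + v i ⟫) - σ * (⟪ coord vᶻ s ⟫ * ⟪ w i ⟫ - ⟪ coord w s ⟫ * ⟪ + v i ⟫)
            ≈⟨ solve 7 (λ x m v s a w b → (x :- m :* v) :- s :* (a :* w :- b :* v) :=
                 x :- ((s :* a) :* w :+ (m :- s :* b) :* v)) refl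
                 (X i) μ ⟪ + v i ⟫ σ ⟪ coord vᶻ s ⟫ ⟪ w i ⟫ ⟪ coord w s ⟫ ⟩
          X i - ((σ * ⟪ coord vᶻ s ⟫) * ⟪ w i ⟫ + (μ - σ * ⟪ coord w s ⟫) * ⟪ + v i ⟫) ∎)
        (proj₂ run i)
        where
        lonely = lvp (pair vᶻ w) (pair-admissible v v>0 v-injective w w∦v)
        s      = proj₁ lonely
        b      = proj₁ (tied s)
        last≡b = proj₁ (proj₂ (tied s))
        μ      = proj₁ (proj₂ (proj₂ (tied s)))
        run    = shiftedLonely-insertAt (det s) (λ i → X i - μ * ⟪ + v i ⟫) b
                   (removeAt-velocities (det s) s b last≡b (lonely-dets v v>0 v-injective w s (proj₂ lonely)))
                   (proj₂ (proj₂ (proj₂ (tied s))))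
        σ      = proj₁ run

    -- A segment of lattice length N in the direction Σ wᵢuᵢ allows to cover
    -- with ρ + 1/N what the shifted lonely runners cover with ρ, modulo that
    -- direction.
    zonotopeCovers : ∀ {e} (v : Vector ℕ (suc (suc d))) → (∀ i → 0 ℕ.< v i) → Injective _≡_ _≡_ v →
      LonelyVectorProperty (suc (suc d)) →
      (u : Vector (Vector ℤ e) (suc (suc d))) → Generates u → (∀ j → Σᶻ (λ i → + v i ℤ.* u i j) ≡ 0ℤ) →
      (w : Vector ℤ (suc (suc d))) → ¬ (∀ i j → + v i ℤ.* w j ≡ w i ℤ.* + v j) →
      (N : ℤ) (κ : ℚ) → 0ℚ ℚ.≤ κ → κ ℚ.* N /1 ≡ 1ℚ →
      (p q : Vector Carrier (suc (suc d))) → (∀ i → InBox 1ℚ (p i)) → (∀ i → InBox 1ℚ (q i)) →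
      (∀ j → sum (λ i → p i * ⟪ u i j ⟫) ≈ sum (λ i → (q i + ⟪ N ⟫ * ⟪ w i ⟫) * ⟪ u i j ⟫)) →
      ZonotopeCovers (ρ ℚ.+ κ) u
    zonotopeCovers {e} v v>0 v-injective lvp u gen relation w w∦v N κ κ≥0 κN≡1 p q p∈box q∈box p≈q+Nw x =
      T , Z , T∈box , covered
      where
      X  = proj₁ (lift-generates u gen x)
      x≈ = proj₂ (lift-generates u gen x)
      k  = ι κ

      -- The segment will be used in the size κ, starting at κq; this starting point is subtracted
      -- in advance.
      run    = shiftedLonely-plane v v>0 v-injective w (λ i → X i - k * q i) lvp w∦v
      σ      = proj₁ run
      μ      = proj₁ (proj₂ run)
      within = proj₂ (proj₂ run)
      -- Of the displacement σw, the multiple zw is a lattice vector. The remaining τw with 0 ≤ τ ≤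
      -- 1 becomes a partial run along the segment from κq to κp, which represents w because κN = 1.
      z      = proj₁ (floor σ)
      τ      = σ - ⟪ z ⟫
      t      = λ i → proj₁ (within i)
      c      = λ i → proj₁ (proj₂ (within i))

      T : Vector Carrier (suc (suc d))
      T i = t i + k * (τ * p i + (ι 1ℚ - τ) * q i)

      Z : Vector ℤ e
      Z j = Σᶻ (λ i → (c i ℤ.+ z ℤ.* w i) ℤ.* u i j)

      T∈box : ∀ i → InBox (ρ ℚ.+ κ) (T i)
      T∈box i =
        nonNeg-+ t≥0 (nonNeg-* k≥0 (nonNeg-+ (nonNeg-* τ≥0 (proj₁ (p∈box i))) (nonNeg-* τ≤1 (proj₁ (q∈box i))))) ,
        nonNeg-resp (begin
          (ι ρ - t i) + k * (τ * (ι 1ℚ - p i) + (ι 1ℚ - τ) * (ι 1ℚ - q i))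
            ≈⟨ solve 6 (λ ρ t k τ p q →
                 (ρ :- t) :+ k :* (τ :* (con 1ℤ :- p) :+ (con 1ℤ :- τ) :* (con 1ℤ :- q)) :=
                 (ρ :+ k) :- (t :+ k :* (τ :* p :+ (con 1ℤ :- τ) :* q))) refl (ι ρ) (t i) k τ (p i) (q i) ⟩
          (ι ρ + k) - T i
            ≈⟨ +-congʳ (ι-+ ρ κ) ⟨
          ι (ρ ℚ.+ κ) - T i ∎)
          (nonNeg-+ t≤ρ (nonNeg-* k≥0 (nonNeg-+ (nonNeg-* τ≥0 (proj₂ (p∈box i))) (nonNeg-* τ≤1 (proj₂ (q∈box i))))))
        where
        t≥0 = proj₁ (proj₁ (proj₂ (proj₂ (within i))))
        t≤ρ = proj₂ (proj₁ (proj₂ (proj₂ (within i))))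
        τ≥0 = proj₁ (proj₂ (floor σ))
        τ≤1 = proj₂ (proj₂ (floor σ))
        k≥0 = nonNeg-ι κ≥0

      -- The discrepancy of the coefficients that `u` does not see: w against κ(p - q), and a
      -- multiple of v.
      null : Vector Carrier (suc (suc d))
      null i = τ * (⟪ w i ⟫ + k * (q i - p i)) + μ * ⟪ + v i ⟫

      X≈ : ∀ i → X i ≈ (T i + ⟪ c i ℤ.+ z ℤ.* w i ⟫) + null i
      X≈ i = begin
        X i
          ≈⟨ solve 3 (λ x a b → x := ((x :- a) :- b) :+ (a :+ b)) refl (X i) (k * q i) (σ * ⟪ w i ⟫ + μ * ⟪ + v i ⟫) ⟩
        ((X i - k * q i) - (σ * ⟪ w i ⟫ + μ * ⟪ + v i ⟫)) + (k * q i + (σ * ⟪ w i ⟫ + μ * ⟪ + v i ⟫))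
          ≈⟨ +-congʳ (proj₂ (proj₂ (proj₂ (within i)))) ⟩
        (t i + ⟪ c i ⟫) + (k * q i + (σ * ⟪ w i ⟫ + μ * ⟪ + v i ⟫))
          ≈⟨ solve 9 (λ t c k p q σ z w m → (t :+ c) :+ (k :* q :+ (σ :* w :+ m)) :=
               ((t :+ k :* ((σ :- z) :* p :+ (con 1ℤ :- (σ :- z)) :* q)) :+ (c :+ z :* w)) :+
               ((σ :- z) :* (w :+ k :* (q :- p)) :+ m)) refl
               (t i) ⟪ c i ⟫ k (p i) (q i) σ ⟪ z ⟫ ⟪ w i ⟫ (μ * ⟪ + v i ⟫) ⟩
        (T i + (⟪ c i ⟫ + ⟪ z ⟫ * ⟪ w i ⟫)) + null i
          ≈⟨ +-congʳ (+-congˡ (trans (⟪⟫-+ (c i) (z ℤ.* w i)) (+-congˡ (⟪⟫-* z (w i))))) ⟨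
        (T i + ⟪ c i ℤ.+ z ℤ.* w i ⟫) + null i ∎

      module _ (j : Fin e) where
        uⱼ : Vector Carrier (suc (suc d))
        uⱼ i = ⟪ u i j ⟫

        direction≈0 : sum (λ i → (⟪ w i ⟫ + k * (q i - p i)) * uⱼ i) ≈ 0#
        direction≈0 = begin
          sum (λ i → (⟪ w i ⟫ + k * (q i - p i)) * uⱼ i)
            ≈⟨ sum-cong (λ i → *-congʳ {uⱼ i} (begin
                 ⟪ w i ⟫ + k * (q i - p i)
                   ≈⟨ +-congʳ (trans (*-congʳ kN≈1) (*-identityˡ ⟪ w i ⟫)) ⟨
                 (k * ⟪ N ⟫) * ⟪ w i ⟫ + k * (q i - p i)
                   ≈⟨ solve 5 (λ k N w p q → (k :* N) :* w :+ k :* (q :- p) := k :* ((q :+ N :* w) :- p))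
                        refl k ⟪ N ⟫ ⟪ w i ⟫ (p i) (q i) ⟩
                 k * ((q i + ⟪ N ⟫ * ⟪ w i ⟫) - p i) ∎)) ⟩
          sum (λ i → (k * ((q i + ⟪ N ⟫ * ⟪ w i ⟫) - p i)) * uⱼ i)
            ≈⟨ sum-scale-* k (λ i → (q i + ⟪ N ⟫ * ⟪ w i ⟫) - p i) uⱼ ⟩
          k * sum (λ i → ((q i + ⟪ N ⟫ * ⟪ w i ⟫) - p i) * uⱼ i)
            ≈⟨ *-congˡ (+-cancelʳ (sum (λ i → p i * uⱼ i)) _ 0# (begin
                 sum (λ i → ((q i + ⟪ N ⟫ * ⟪ w i ⟫) - p i) * uⱼ i) + sum (λ i → p i * uⱼ i)
                   ≈⟨ sum-+-* (λ i → (q i + ⟪ N ⟫ * ⟪ w i ⟫) - p i) p uⱼ ⟨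
                 sum (λ i → (((q i + ⟪ N ⟫ * ⟪ w i ⟫) - p i) + p i) * uⱼ i)
                   ≈⟨ sum-cong (λ i → *-congʳ {uⱼ i} (solve 2 (λ a b → (a :- b) :+ b := a) refl (q i + ⟪ N ⟫ * ⟪ w i ⟫) (p i))) ⟩
                 sum (λ i → (q i + ⟪ N ⟫ * ⟪ w i ⟫) * uⱼ i)
                   ≈⟨ p≈q+Nw j ⟨
                 sum (λ i → p i * uⱼ i)
                   ≈⟨ +-identityˡ _ ⟨
                 0# + sum (λ i → p i * uⱼ i) ∎)) ⟩
          k * 0#
            ≈⟨ zeroʳ k ⟩
          0# ∎
          where
          kN≈1 : k * ⟪ N ⟫ ≈ 1#
          kN≈1 = trans (sym (ι-* κ (N /1))) (trans (reflexive (cong ι κN≡1)) ι-1)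

        null≈0 : sum (λ i → null i * uⱼ i) ≈ 0#
        null≈0 = begin
          sum (λ i → null i * uⱼ i)
            ≈⟨ sum-+-* (λ i → τ * (⟪ w i ⟫ + k * (q i - p i))) (λ i → μ * ⟪ + v i ⟫) uⱼ ⟩
          sum (λ i → (τ * (⟪ w i ⟫ + k * (q i - p i))) * uⱼ i) + sum (λ i → (μ * ⟪ + v i ⟫) * uⱼ i)
            ≈⟨ +-cong (sum-scale-* τ (λ i → ⟪ w i ⟫ + k * (q i - p i)) uⱼ) (sum-scale-* μ (λ i → ⟪ + v i ⟫) uⱼ) ⟩
          τ * sum (λ i → (⟪ w i ⟫ + k * (q i - p i)) * uⱼ i) + μ * sum (λ i → ⟪ + v i ⟫ * uⱼ i)
            ≈⟨ +-cong (*-congˡ direction≈0) (*-congˡ (trans (sum-⟪⟫-* (λ i → + v i) (λ i → u i j))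
                 (trans (reflexive (cong ⟪_⟫ (relation j))) ι-0))) ⟩
          τ * 0# + μ * 0#
            ≈⟨ +-cong (zeroʳ τ) (zeroʳ μ) ⟩
          0# + 0#
            ≈⟨ +-identityʳ 0# ⟩
          0# ∎

        covered : x j ≈ sum (λ i → T i * uⱼ i) + ⟪ Z j ⟫
        covered = begin
          x j
            ≈⟨ x≈ j ⟩
          sum (λ i → X i * uⱼ i)
            ≈⟨ sum-cong (λ i → *-congʳ {uⱼ i} (X≈ i)) ⟩
          sum (λ i → ((T i + ⟪ c i ℤ.+ z ℤ.* w i ⟫) + null i) * uⱼ i)
            ≈⟨ sum-+-* (λ i → T i + ⟪ c i ℤ.+ z ℤ.* w i ⟫) null uⱼ ⟩
          sum (λ i → (T i + ⟪ c i ℤ.+ z ℤ.* w i ⟫) * uⱼ i) + sum (λ i → null i * uⱼ i)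
            ≈⟨ trans (+-congˡ null≈0) (+-identityʳ _) ⟩
          sum (λ i → (T i + ⟪ c i ℤ.+ z ℤ.* w i ⟫) * uⱼ i)
            ≈⟨ sum-+-* T (λ i → ⟪ c i ℤ.+ z ℤ.* w i ⟫) uⱼ ⟩
          sum (λ i → T i * uⱼ i) + sum (λ i → ⟪ c i ℤ.+ z ℤ.* w i ⟫ * uⱼ i)
            ≈⟨ +-congˡ (sum-⟪⟫-* (λ i → c i ℤ.+ z ℤ.* w i) (λ i → u i j)) ⟩
          sum (λ i → T i * uⱼ i) + ⟪ Z j ⟫ ∎

    congruentPoints⇒covers : ∀ {e} (v : Vector ℕ (suc (suc d))) → (∀ i → 0 ℕ.< v i) → Injective _≡_ _≡_ v →
      LonelyVectorProperty (suc (suc d)) →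
      (u : Vector (Vector ℤ e) (suc (suc d))) → Generates u → (∀ j → Σᶻ (λ i → + v i ℤ.* u i j) ≡ 0ℤ) →
      (N : ℤ) (κ : ℚ) → 0ℚ ℚ.≤ κ → κ ℚ.* N /1 ≡ 1ℚ →
      (P Q W : Vector ℤ e) → (∀ j → P j ≡ Q j ℤ.+ N ℤ.* W j) → ¬ (∀ j → W j ≡ 0ℤ) →
      InZonotope u (λ j → ⟪ P j ⟫) → InZonotope u (λ j → ⟪ Q j ⟫) → ZonotopeCovers (ρ ℚ.+ κ) u
    congruentPoints⇒covers {e} v v>0 v-injective lvp u gen relation N κ κ≥0 κN≡1 P Q W P≡Q+NW W≢0
      (p , p∈box , P≈) (q , q∈box , Q≈) =
      zonotopeCovers v v>0 v-injective lvp u gen relation w w∦v N κ κ≥0 κN≡1 p q p∈box q∈box λ j → begin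
        sum (λ i → p i * ⟪ u i j ⟫)
          ≈⟨ P≈ j ⟨
        ⟪ P j ⟫
          ≡⟨ cong ⟪_⟫ (P≡Q+NW j) ⟩
        ⟪ Q j ℤ.+ N ℤ.* W j ⟫
          ≈⟨ ⟪⟫-+ (Q j) (N ℤ.* W j) ⟩
        ⟪ Q j ⟫ + ⟪ N ℤ.* W j ⟫
          ≈⟨ +-cong (Q≈ j) (trans (⟪⟫-* N (W j)) (*-congˡ (trans (reflexive (cong ⟪_⟫ (W≡ j)))
               (sym (sum-⟪⟫-* w (λ i → u i j)))))) ⟩
        sum (λ i → q i * ⟪ u i j ⟫) + ⟪ N ⟫ * sum (λ i → ⟪ w i ⟫ * ⟪ u i j ⟫)
          ≈⟨ +-congˡ (sum-scale-* ⟪ N ⟫ (λ i → ⟪ w i ⟫) (λ i → ⟪ u i j ⟫)) ⟨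
        sum (λ i → q i * ⟪ u i j ⟫) + sum (λ i → (⟪ N ⟫ * ⟪ w i ⟫) * ⟪ u i j ⟫)
          ≈⟨ sum-+-* q (λ i → ⟪ N ⟫ * ⟪ w i ⟫) (λ i → ⟪ u i j ⟫) ⟨
        sum (λ i → (q i + ⟪ N ⟫ * ⟪ w i ⟫) * ⟪ u i j ⟫) ∎
      where
      w  = proj₁ (gen W)
      W≡ = proj₂ (gen W)

      -- Vanishing of all determinants gives v₀wᵢ = w₀vᵢ, so that v₀W = w₀ Σ vᵢuᵢ = 0.
      w∦v : ¬ (∀ i j → + v i ℤ.* w j ≡ w i ℤ.* + v j)
      w∦v v∥w = W≢0 λ j → [ ⊥-elim ∘ v₀≢0 , (λ W≡0 → W≡0) ]′ (ℤ.i*j≡0⇒i≡0∨j≡0 (+ v zero) (v₀W≡0 j))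
        where
        v₀≢0 : + v zero ≢ 0ℤ
        v₀≢0 eq = ℕ.<⇒≢ (v>0 zero) (≡.sym (ℤ.+-injective eq))
        v₀W≡0 : ∀ j → + v zero ℤ.* W j ≡ 0ℤ
        v₀W≡0 j = ≡.trans (cong (λ z → + v zero ℤ.* z) (W≡ j)) (≡.trans (∑ᶻ.*-distribˡ-sum (+ v zero) (λ i → w i ℤ.* u i j))
          (≡.trans (∑ᶻ.sum-cong-≗ λ i → ≡.trans (≡.sym (ℤ.*-assoc (+ v zero) (w i) (u i j)))
              (≡.trans (cong (ℤ._* u i j) (v∥w zero i)) (ℤ.*-assoc (w zero) (+ v i) (u i j))))
            (≡.trans (≡.sym (∑ᶻ.*-distribˡ-sum (w zero) (λ i → + v i ℤ.* u i j)))
              (≡.trans (cong (λ z → w zero ℤ.* z) (relation j)) (ℤ.*-zeroʳ (w zero))))))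

-- Null sequences of rational numbers

open ≡ using (refl; sym; trans)

open ℚSolver using (solve; con; _:=_; _:+_; _:*_; _:-_; :-_)

½ε+½ε≡ε : ∀ ε → ½ ℚ.* ε ℚ.+ ½ ℚ.* ε ≡ ε
½ε+½ε≡ε ε = trans (sym (ℚ.*-distribʳ-+ ε ½ ½)) (ℚ.*-identityˡ ε)

0<½ε : ∀ {ε} → 0ℚ ℚ.< ε → 0ℚ ℚ.< ½ ℚ.* ε
0<½ε {ε} ε>0 = subst (ℚ._< ½ ℚ.* ε) (ℚ.*-zeroʳ ½) (ℚ.*-monoʳ-<-pos ½ ε>0)

B*δ≡ε : ∀ B ε → 0ℚ ℚ.< B → 0ℚ ℚ.< ε → ∃[ δ ] 0ℚ ℚ.< δ × B ℚ.* δ ≡ ε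
B*δ≡ε B ε B>0 ε>0 =
  1/ B ℚ.* ε
  , subst (ℚ._< 1/ B ℚ.* ε) (ℚ.*-zeroʳ (1/ B)) (ℚ.*-monoʳ-<-pos (1/ B) ε>0)
  , trans (sym (ℚ.*-assoc B (1/ B) ε)) (trans (cong (ℚ._* ε) (ℚ.*-inverseʳ B)) (ℚ.*-identityˡ ε))
  where
  instance
    B-pos     = ℚ.positive B>0
    B-nonZero = ℚ.pos⇒nonZero B {{ℚ.positive B>0}}
    1/B-pos   = ℚ.1/pos⇒pos B {{ℚ.positive B>0}}

p≤∣p∣ : ∀ p → p ℚ.≤ ∣ p ∣
p≤∣p∣ p with ℚ.∣p∣≡p∨∣p∣≡-p p
... | inj₁ eq = ℚ.≤-reflexive (sym eq)
... | inj₂ eq = ℚ.≤-trans (subst (ℚ._≤ 0ℚ) (trans (cong ℚ.-_ eq) (solve 1 (λ p → :- (:- p) := p) refl p))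
                  (ℚ.neg-antimono-≤ (ℚ.0≤∣p∣ p))) (ℚ.0≤∣p∣ p)

p≤q⇒0≤q-p : ∀ {p q} → p ℚ.≤ q → 0ℚ ℚ.≤ q ℚ.- p
p≤q⇒0≤q-p {p} {q} p≤q = subst (ℚ._≤ q ℚ.- p) (ℚ.+-inverseʳ p) (ℚ.+-monoˡ-≤ (ℚ.- p) p≤q)

0≤q-p⇒p≤q : ∀ {p q} → 0ℚ ℚ.≤ q ℚ.- p → p ℚ.≤ q
0≤q-p⇒p≤q {p} {q} 0≤q-p = subst₂ ℚ._≤_ (ℚ.+-identityˡ p) (solve 2 (λ p q → (q :- p) :+ p := q) refl p q) (ℚ.+-monoˡ-≤ p 0≤q-p)

∣p∣≤q⇒0≤q-p : ∀ {p q} → ∣ p ∣ ℚ.≤ q → 0ℚ ℚ.≤ q ℚ.- p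
∣p∣≤q⇒0≤q-p {p} ∣p∣≤q = p≤q⇒0≤q-p (ℚ.≤-trans (p≤∣p∣ p) ∣p∣≤q)

∣p∣≤q⇒0≤q+p : ∀ {p q} → ∣ p ∣ ℚ.≤ q → 0ℚ ℚ.≤ q ℚ.+ p
∣p∣≤q⇒0≤q+p {p} {q} ∣p∣≤q = subst (0ℚ ℚ.≤_) (solve 2 (λ p q → q :- (:- p) := q :+ p) refl p q)
  (∣p∣≤q⇒0≤q-p (subst (ℚ._≤ q) (sym (ℚ.∣-p∣≡∣p∣ p)) ∣p∣≤q))

0≤+ : ∀ {p q} → 0ℚ ℚ.≤ p → 0ℚ ℚ.≤ q → 0ℚ ℚ.≤ p ℚ.+ q
0≤+ = ℚ.+-mono-≤

0≤* : ∀ {p q} → 0ℚ ℚ.≤ p → 0ℚ ℚ.≤ q → 0ℚ ℚ.≤ p ℚ.* q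
0≤* {p} {q} 0≤p 0≤q = subst (ℚ._≤ p ℚ.* q) (ℚ.*-zeroʳ p) (ℚ.*-monoˡ-≤-nonNeg p {{ℚ.nonNegative 0≤p}} 0≤q)

Null : (ℕ → ℚ) → Set
Null s = ∀ ε → 0ℚ ℚ.< ε → Eventually λ n → ∣ s n ∣ ℚ.< ε

Bounded : (ℕ → ℚ) → Set
Bounded s = ∃[ B ] 0ℚ ℚ.< B × Eventually λ n → ∣ s n ∣ ℚ.≤ B

_∧ᴱ_ : ∀ {P Q} → Eventually P → Eventually Q → Eventually (λ n → P n × Q n)
(M , p) ∧ᴱ (N , q) = M ℕ.⊔ N , λ n n≥ → p n (ℕ.m⊔n≤o⇒m≤o M N n≥) , q n (ℕ.m⊔n≤o⇒n≤o M N n≥)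

mapᴱ : ∀ {P Q : ℕ → Set} → (∀ n → P n → Q n) → Eventually P → Eventually Q
mapᴱ f (N , p) = N , λ n n≥ → f n (p n n≥)

cauchy⇒bounded : ∀ {s} → IsCauchy s → Bounded s
cauchy⇒bounded {s} cs with N , close ← cs 1ℚ (ℚ.positive⁻¹ 1ℚ) =
  ∣ s N ∣ ℚ.+ 1ℚ , ℚ.+-mono-≤-< (ℚ.0≤∣p∣ (s N)) (ℚ.positive⁻¹ 1ℚ) , N , λ n n≥ → begin
    ∣ s n ∣                        ≡⟨ cong ∣_∣ (solve 2 (λ a b → a := b :+ (a :- b)) refl (s n) (s N)) ⟩
    ∣ s N ℚ.+ (s n ℚ.- s N) ∣      ≤⟨ ℚ.∣p+q∣≤∣p∣+∣q∣ (s N) (s n ℚ.- s N) ⟩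
    ∣ s N ∣ ℚ.+ ∣ s n ℚ.- s N ∣    ≤⟨ ℚ.+-monoʳ-≤ ∣ s N ∣ (ℚ.<⇒≤ (close n N n≥ ℕ.≤-refl)) ⟩
    ∣ s N ∣ ℚ.+ 1ℚ                 ∎
  where open ℚ.≤-Reasoning

null-resp : ∀ {s t} → (∀ n → s n ≡ t n) → Null s → Null t
null-resp s≗t s→0 ε ε>0 = mapᴱ (λ n → subst (λ z → ∣ z ∣ ℚ.< ε) (s≗t n)) (s→0 ε ε>0)

null-+ : ∀ {s t} → Null s → Null t → Null (λ n → s n ℚ.+ t n)
null-+ {s} {t} s→0 t→0 ε ε>0 = mapᴱ (λ n (s<½ε , t<½ε) → begin-strict
    ∣ s n ℚ.+ t n ∣           ≤⟨ ℚ.∣p+q∣≤∣p∣+∣q∣ (s n) (t n) ⟩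
    ∣ s n ∣ ℚ.+ ∣ t n ∣       <⟨ ℚ.+-mono-< s<½ε t<½ε ⟩
    ½ ℚ.* ε ℚ.+ ½ ℚ.* ε       ≡⟨ ½ε+½ε≡ε ε ⟩
    ε                         ∎)
  (s→0 (½ ℚ.* ε) (0<½ε ε>0) ∧ᴱ t→0 (½ ℚ.* ε) (0<½ε ε>0))
  where open ℚ.≤-Reasoning

null-neg : ∀ {s} → Null s → Null (λ n → ℚ.- s n)
null-neg {s} s→0 ε ε>0 = mapᴱ (λ n → subst (ℚ._< ε) (sym (ℚ.∣-p∣≡∣p∣ (s n)))) (s→0 ε ε>0)

null-* : ∀ {s t} → Bounded s → Null t → Null (λ n → s n ℚ.* t n)
null-* {s} {t} (B , B>0 , s≤B) t→0 ε ε>0 with δ , δ>0 , Bδ≡ε ← B*δ≡ε B ε B>0 ε>0 =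
  mapᴱ (λ n (s≤B , t<δ) → begin-strict
    ∣ s n ℚ.* t n ∣        ≡⟨ ℚ.∣p*q∣≡∣p∣*∣q∣ (s n) (t n) ⟩
    ∣ s n ∣ ℚ.* ∣ t n ∣    ≤⟨ ℚ.*-monoʳ-≤-nonNeg ∣ t n ∣ {{ℚ.nonNegative (ℚ.0≤∣p∣ (t n))}} s≤B ⟩
    B ℚ.* ∣ t n ∣          <⟨ ℚ.*-monoʳ-<-pos B {{ℚ.positive B>0}} t<δ ⟩
    B ℚ.* δ                ≡⟨ Bδ≡ε ⟩
    ε                      ∎)
  (s≤B ∧ᴱ t→0 δ δ>0)
  where open ℚ.≤-Reasoning

-- The ordered ring of real numbers

-ᴿ_ : ℝ → ℝ
-ᴿ x = mkℝ (λ n → ℚ.- seq x n) λ ε ε>0 → let N , close = cauchy x ε ε>0 in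
  N , λ m n m≥ n≥ → subst (ℚ._< ε)
    (trans (sym (ℚ.∣-p∣≡∣p∣ (seq x m ℚ.- seq x n)))
      (cong ∣_∣ (solve 2 (λ a b → :- (a :- b) := (:- a) :- (:- b)) refl (seq x m) (seq x n))))
    (close m n m≥ n≥)

-- `_≈ᴿ_` unfolds to a function type from which unification cannot recover the two reals; a record
-- type keeps them as parameters.
record _≋_ (x y : ℝ) : Set where
  constructor wrap
  field unwrap : x ≈ᴿ y

open _≋_ public

pointwise : ∀ {x y} → (∀ n → seq x n ≡ seq y n) → x ≋ y
pointwise {x} {y} x≗y = wrap λ ε ε>0 → 0 , λ n _ →
  subst (ℚ._< ε) (sym (cong ∣_∣ (trans (cong (ℚ._- seq y n) (x≗y n)) (ℚ.+-inverseʳ (seq y n))))) ε>0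

≋-isEquivalence : IsEquivalence _≋_
≋-isEquivalence = record
  { refl  = pointwise λ _ → refl
  ; sym   = λ {x} {y} (wrap x≈y) → wrap (null-resp
      (λ n → solve 2 (λ x y → :- (x :- y) := y :- x) refl (seq x n) (seq y n)) (null-neg x≈y))
  ; trans = λ {x} {y} {z} (wrap x≈y) (wrap y≈z) → wrap (null-resp
      (λ n → solve 3 (λ x y z → (x :- y) :+ (y :- z) := x :- z) refl (seq x n) (seq y n) (seq z n)) (null-+ x≈y y≈z))
  }

ℝ-commutativeRing : CommutativeRing 0ℓ 0ℓ
ℝ-commutativeRing = record
  { Carrier = ℝ ; _≈_ = _≋_ ; _+_ = _+ᴿ_ ; _*_ = _*ᴿ_ ; -_ = -ᴿ_ ; 0# = 0ᴿ ; 1# = 1ᴿ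
  ; isCommutativeRing = record
    { isRing = record
      { +-isAbelianGroup = record
        { isGroup = record
          { isMonoid = record
            { isSemigroup = record
              { isMagma = record
                { isEquivalence = ≋-isEquivalence
                ; ∙-cong = λ {x} {x′} {y} {y′} (wrap x≈x′) (wrap y≈y′) → wrap (null-resp
                    (λ n → solve 4 (λ x x′ y y′ → (x :- x′) :+ (y :- y′) := (x :+ y) :- (x′ :+ y′)) refl
                      (seq x n) (seq x′ n) (seq y n) (seq y′ n)) (null-+ x≈x′ y≈y′))
                }
              ; assoc = λ x y z → pointwise λ n → ℚ.+-assoc (seq x n) (seq y n) (seq z n)
              }
            ; identity = (λ x → pointwise λ n → ℚ.+-identityˡ (seq x n)) , λ x → pointwise λ n → ℚ.+-identityʳ (seq x n)
            }
          ; inverse = (λ x → pointwise λ n → ℚ.+-inverseˡ (seq x n)) , λ x → pointwise λ n → ℚ.+-inverseʳ (seq x n)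
          ; ⁻¹-cong = λ {x} {y} (wrap x≈y) → wrap (null-resp
              (λ n → solve 2 (λ x y → :- (x :- y) := (:- x) :- (:- y)) refl (seq x n) (seq y n)) (null-neg x≈y))
          }
        ; comm = λ x y → pointwise λ n → ℚ.+-comm (seq x n) (seq y n)
        }
      ; *-cong = λ {x} {x′} {y} {y′} (wrap x≈x′) (wrap y≈y′) → wrap (null-resp
          (λ n → solve 4 (λ x x′ y y′ → x :* (y :- y′) :+ y′ :* (x :- x′) := x :* y :- x′ :* y′) refl
            (seq x n) (seq x′ n) (seq y n) (seq y′ n))
          (null-+ (null-* {seq x} (cauchy⇒bounded (cauchy x)) y≈y′) (null-* {seq y′} (cauchy⇒bounded (cauchy y′)) x≈x′)))
      ; *-assoc = λ x y z → pointwise λ n → ℚ.*-assoc (seq x n) (seq y n) (seq z n)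
      ; *-identity = (λ x → pointwise λ n → ℚ.*-identityˡ (seq x n)) , λ x → pointwise λ n → ℚ.*-identityʳ (seq x n)
      ; distrib = (λ x y z → pointwise λ n → ℚ.*-distribˡ-+ (seq x n) (seq y n) (seq z n))
                , λ x y z → pointwise λ n → ℚ.*-distribʳ-+ (seq x n) (seq y n) (seq z n)
      }
    ; *-comm = λ x y → pointwise λ n → ℚ.*-comm (seq x n) (seq y n)
    }
  }

Nonneg : ℝ → Set
Nonneg x = 0ᴿ ≤ᴿ x

≤ᴿ⇒nonneg : ∀ {x y} → x ≤ᴿ y → Nonneg (y +ᴿ -ᴿ x)
≤ᴿ⇒nonneg {x} {y} x≤y ε ε>0 = mapᴱ (λ n x≤y+ε → subst (0ℚ ℚ.≤_)
  (solve 3 (λ x y ε → (y :+ ε) :- x := (y :- x) :+ ε) refl (seq x n) (seq y n) ε) (p≤q⇒0≤q-p x≤y+ε)) (x≤y ε ε>0)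

nonneg⇒≤ᴿ : ∀ {x y} → Nonneg (y +ᴿ -ᴿ x) → x ≤ᴿ y
nonneg⇒≤ᴿ {x} {y} 0≤y-x ε ε>0 = mapᴱ (λ n 0≤ → 0≤q-p⇒p≤q (subst (0ℚ ℚ.≤_)
  (solve 3 (λ x y ε → (y :- x) :+ ε := (y :+ ε) :- x) refl (seq x n) (seq y n) ε) 0≤)) (0≤y-x ε ε>0)

eventually-nonneg : ∀ {x} → Eventually (λ n → 0ℚ ℚ.≤ seq x n) → Nonneg x
eventually-nonneg 0≤x ε ε>0 = mapᴱ (λ n 0≤xₙ → 0≤+ 0≤xₙ (ℚ.<⇒≤ ε>0)) 0≤x

nonneg-resp : ∀ {x y} → x ≋ y → Nonneg x → Nonneg y
nonneg-resp {x} {y} (wrap x≈y) 0≤x ε ε>0 = mapᴱ (λ n (x≈y , 0≤x) → subst (0ℚ ℚ.≤_)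
    (trans (solve 3 (λ x y h → (x :+ h) :+ (h :- (x :- y)) := y :+ (h :+ h)) refl (seq x n) (seq y n) (½ ℚ.* ε))
      (cong (seq y n ℚ.+_) (½ε+½ε≡ε ε)))
    (0≤+ 0≤x (∣p∣≤q⇒0≤q-p (ℚ.<⇒≤ x≈y))))
  (x≈y (½ ℚ.* ε) (0<½ε ε>0) ∧ᴱ 0≤x (½ ℚ.* ε) (0<½ε ε>0))

nonneg-≗ : ∀ x y → (∀ n → seq x n ≡ seq y n) → Nonneg x → Nonneg y
nonneg-≗ x y x≗y = nonneg-resp {x} {y} (pointwise x≗y)

nonneg-+ : ∀ {x y} → Nonneg x → Nonneg y → Nonneg (x +ᴿ y)
nonneg-+ {x} {y} 0≤x 0≤y ε ε>0 = mapᴱ (λ n (0≤x , 0≤y) → subst (0ℚ ℚ.≤_)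
    (trans (solve 3 (λ x y h → (x :+ h) :+ (y :+ h) := (x :+ y) :+ (h :+ h)) refl (seq x n) (seq y n) (½ ℚ.* ε))
      (cong (seq x n ℚ.+ seq y n ℚ.+_) (½ε+½ε≡ε ε)))
    (0≤+ 0≤x 0≤y))
  (0≤x (½ ℚ.* ε) (0<½ε ε>0) ∧ᴱ 0≤y (½ ℚ.* ε) (0<½ε ε>0))

-- With the errors `δ` and `η` added, the factors are non-negative. Expanding (x + δ)(y + η) leaves
-- the terms xη and yδ of unknown sign, which (B - x)η and (B′ - y)δ turn into constants.
0≤xy+ε : ∀ {x y δ η B B′ ε} → (B ℚ.+ δ) ℚ.* η ≡ ½ ℚ.* ε → B′ ℚ.* δ ≡ ½ ℚ.* ε → 0ℚ ℚ.≤ δ → 0ℚ ℚ.≤ η →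
  ∣ x ∣ ℚ.≤ B → ∣ y ∣ ℚ.≤ B′ → 0ℚ ℚ.≤ x ℚ.+ δ → 0ℚ ℚ.≤ y ℚ.+ η → 0ℚ ℚ.≤ x ℚ.* y ℚ.+ ε
0≤xy+ε {x} {y} {δ} {η} {B} {B′} {ε} B+δη≡½ε B′δ≡½ε 0≤δ 0≤η x≤B y≤B′ 0≤x+δ 0≤y+η = subst (0ℚ ℚ.≤_)
  (begin
    ((x ℚ.+ δ) ℚ.* (y ℚ.+ η) ℚ.+ (B ℚ.- x) ℚ.* η) ℚ.+ (B′ ℚ.- y) ℚ.* δ
      ≡⟨ solve 6 (λ x y δ η B B′ →
           ((x :+ δ) :* (y :+ η) :+ (B :- x) :* η) :+ (B′ :- y) :* δ :=
           x :* y :+ ((B :+ δ) :* η :+ B′ :* δ)) refl x y δ η B B′ ⟩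
    x ℚ.* y ℚ.+ ((B ℚ.+ δ) ℚ.* η ℚ.+ B′ ℚ.* δ)
      ≡⟨ cong (λ z → x ℚ.* y ℚ.+ z) (trans (cong₂ ℚ._+_ B+δη≡½ε B′δ≡½ε) (½ε+½ε≡ε ε)) ⟩
    x ℚ.* y ℚ.+ ε ∎)
  (0≤+ (0≤+ (0≤* 0≤x+δ 0≤y+η) (0≤* (∣p∣≤q⇒0≤q-p x≤B) 0≤η)) (0≤* (∣p∣≤q⇒0≤q-p y≤B′) 0≤δ))
  where open ≡.≡-Reasoning

nonneg-* : ∀ {x y} → Nonneg x → Nonneg y → Nonneg (x *ᴿ y)
nonneg-* {x} {y} 0≤x 0≤y ε ε>0 =
  let B , B>0 , x≤B    = cauchy⇒bounded (cauchy x)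
      B′ , B′>0 , y≤B′    = cauchy⇒bounded (cauchy y)
      δ , δ>0 , B′δ     = B*δ≡ε B′ (½ ℚ.* ε) B′>0 (0<½ε ε>0)
      -- `η` is chosen after `δ`, since its factor is B + δ.
      η , η>0 , [B+δ]η = B*δ≡ε (B ℚ.+ δ) (½ ℚ.* ε) (ℚ.+-mono-< B>0 δ>0) (0<½ε ε>0)
  in mapᴱ (λ n ((x≤B , y≤B′) , (0≤x , 0≤y)) →
       0≤xy+ε {seq x n} {seq y n} {δ} {η} {B} {B′} {ε} [B+δ]η B′δ (ℚ.<⇒≤ δ>0) (ℚ.<⇒≤ η>0) x≤B y≤B′ 0≤x 0≤y)
     ((x≤B ∧ᴱ y≤B′) ∧ᴱ (0≤x δ δ>0 ∧ᴱ 0≤y η η>0))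

-- The floor of a real number

∣↥_∣ : ℚ → ℕ
∣↥ p ∣ = ℤ.∣ ℚ.↥ p ∣

-- A denominator is at least 1, which makes the absolute numerator an integer upper bound: the
-- Archimedean property.
p≤∣↥p∣ : ∀ p → p ℚ.≤ + ∣↥ p ∣ /1
p≤∣↥p∣ p@(mkℚ n d-1 _) = ℚ.toℚᵘ-cancel-≤ (ℚᵘ.≤-respʳ-≃ (ℚᵘ.≃-sym (toℚᵘ-/1 (+ ∣↥ p ∣))) (ℚᵘ.*≤* (begin
  n ℤ.* 1ℤ                    ≡⟨ ℤ.*-identityʳ n ⟩
  n                           ≤⟨ i≤∣i∣ n ⟩
  + ℤ.∣ n ∣                   ≡⟨ ℤ.*-identityʳ (+ ℤ.∣ n ∣) ⟨
  + ℤ.∣ n ∣ ℤ.* 1ℤ            ≤⟨ ℤ.*-monoˡ-≤-nonNeg (+ ℤ.∣ n ∣) (ℤ.+≤+ (ℕ.s≤s ℕ.z≤n)) ⟩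
  + ℤ.∣ n ∣ ℤ.* + suc d-1     ∎)))
  where
  open ℤ.≤-Reasoning
  i≤∣i∣ : ∀ i → i ℤ.≤ + ℤ.∣ i ∣
  i≤∣i∣ (+ _)      = ℤ.≤-refl
  i≤∣i∣ ℤ.-[1+ _ ] = ℤ.-≤+

module _ (em : ExcludedMiddle 0ℓ) where

  -- The one appeal to excluded middle. If the terms are not eventually non-negative, no late term
  -- exceeds ε: by the Cauchy property all later terms would then be positive.
  nonneg-total : ∀ x → Nonneg x ⊎ Nonneg (-ᴿ x)
  nonneg-total x with em {Eventually (λ n → 0ℚ ℚ.≤ seq x n)}
  ... | yes 0≤x = inj₁ (eventually-nonneg {x} 0≤x)
  ... | no  0≰x = inj₂ λ ε ε>0 → let N , close = cauchy x ε ε>0 in N , λ m m≥ → case-≤ ε N close m m≥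
    where
    case-≤ : ∀ ε N → (∀ m n → N ℕ.≤ m → N ℕ.≤ n → ∣ seq x m ℚ.- seq x n ∣ ℚ.< ε) →
      ∀ m → N ℕ.≤ m → 0ℚ ℚ.≤ ℚ.- seq x m ℚ.+ ε
    case-≤ ε N close m m≥ with 0ℚ ℚ.≤? ℚ.- seq x m ℚ.+ ε
    ... | yes p = p
    ... | no ¬p = ⊥-elim (0≰x (N , λ n n≥ → subst (0ℚ ℚ.≤_)
      (solve 3 (λ a b ε → (ε :- (a :- b)) :- (:- a :+ ε) := b) refl (seq x m) (seq x n) ε)
      (0≤+ (∣p∣≤q⇒0≤q-p (ℚ.<⇒≤ (close m n m≥ n≥))) (ℚ.neg-antimono-≤ (ℚ.<⇒≤ (ℚ.≰⇒> ¬p))))))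

  InUnit : ℝ → ℚ → Set
  InUnit x q = Nonneg (x +ᴿ -ᴿ fromℚ q) × Nonneg (fromℚ 1ℚ +ᴿ -ᴿ (x +ᴿ -ᴿ fromℚ q))

  inUnit : ∀ x p q → q ≡ 1ℚ ℚ.+ p → Nonneg (x +ᴿ -ᴿ fromℚ p) → Nonneg (fromℚ q +ᴿ -ᴿ x) → InUnit x p
  inUnit x p _ refl p≤x x≤1+p = p≤x , nonneg-≗ (fromℚ (1ℚ ℚ.+ p) +ᴿ -ᴿ x) (fromℚ 1ℚ +ᴿ -ᴿ (x +ᴿ -ᴿ fromℚ p))
    (λ n → solve 2 (λ p x → (con 1ℚ :+ p) :- x := con 1ℚ :- (x :- p)) refl p (seq x n)) x≤1+p

  -- Downward search from the upper bound `K`, each comparison with an integer being made by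
  -- `nonneg-total`.
  floor-nonneg : ∀ K x → Nonneg x → Nonneg (fromℚ (+ K /1) +ᴿ -ᴿ x) → ∃[ z ] InUnit x (z /1)
  floor-nonneg zero x 0≤x x≤0 = 0ℤ , inUnit x 0ℚ 1ℚ refl
    (nonneg-≗ x (x +ᴿ -ᴿ 0ᴿ) (λ n → sym (ℚ.+-identityʳ (seq x n))) 0≤x)
    (nonneg-≗ ((fromℚ 0ℚ +ᴿ -ᴿ x) +ᴿ fromℚ 1ℚ) (fromℚ 1ℚ +ᴿ -ᴿ x)
      (λ n → solve 1 (λ x → (con 0ℚ :- x) :+ con 1ℚ := con 1ℚ :- x) refl (seq x n))
      (nonneg-+ {fromℚ 0ℚ +ᴿ -ᴿ x} {fromℚ 1ℚ} x≤0 (eventually-nonneg {fromℚ 1ℚ} (0 , λ _ _ → ℚ.nonNegative⁻¹ 1ℚ))))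
  floor-nonneg (suc K) x 0≤x x≤1+K = case (nonneg-total (x +ᴿ -ᴿ fromℚ (+ K /1)))
    where
    case : Nonneg (x +ᴿ -ᴿ fromℚ (+ K /1)) ⊎ Nonneg (-ᴿ (x +ᴿ -ᴿ fromℚ (+ K /1))) → ∃[ z ] InUnit x (z /1)
    case (inj₁ K≤x) = + K , inUnit x (+ K /1) (+ suc K /1) (/1-+ 1ℤ (+ K)) K≤x x≤1+K
    case (inj₂ x≤K) = floor-nonneg K x 0≤x (nonneg-≗ (-ᴿ (x +ᴿ -ᴿ fromℚ (+ K /1))) (fromℚ (+ K /1) +ᴿ -ᴿ x)
      (λ n → negated (+ K /1) (seq x n)) x≤K)
      where
      negated : ∀ k x → ℚ.- (x ℚ.- k) ≡ k ℚ.- x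
      negated = solve 2 (λ k x → :- (x :- k) := k :- x) refl

  floorᴿ : ∀ x → ∃[ z ] InUnit x (z /1)
  floorᴿ x = z ℤ.- + K
    , nonneg-≗ (x+K +ᴿ -ᴿ fromℚ (z /1)) (x +ᴿ -ᴿ fromℚ ((z ℤ.- + K) /1)) shift (proj₁ z-unit)
    , nonneg-≗ (fromℚ 1ℚ +ᴿ -ᴿ (x+K +ᴿ -ᴿ fromℚ (z /1))) (fromℚ 1ℚ +ᴿ -ᴿ (x +ᴿ -ᴿ fromℚ ((z ℤ.- + K) /1)))
        (λ n → cong (λ q → 1ℚ ℚ.- q) (shift n)) (proj₂ z-unit)
    where
    bounded = cauchy⇒bounded (cauchy x)
    K       = ∣↥ proj₁ bounded ∣
    x+K     = x +ᴿ fromℚ (+ K /1)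

    ∣x∣≤K : Eventually λ n → ∣ seq x n ∣ ℚ.≤ + K /1
    ∣x∣≤K = mapᴱ (λ n x≤B → ℚ.≤-trans x≤B (p≤∣↥p∣ (proj₁ bounded))) (proj₂ (proj₂ bounded))

    0≤x+K : Nonneg x+K
    0≤x+K = eventually-nonneg {x+K} (mapᴱ (λ n x≤K →
      subst (0ℚ ℚ.≤_) (ℚ.+-comm (+ K /1) (seq x n)) (∣p∣≤q⇒0≤q+p x≤K)) ∣x∣≤K)

    x+K≤2K : Nonneg (fromℚ (+ (K ℕ.+ K) /1) +ᴿ -ᴿ x+K)
    x+K≤2K = eventually-nonneg {fromℚ (+ (K ℕ.+ K) /1) +ᴿ -ᴿ x+K} (mapᴱ (λ n x≤K → subst (0ℚ ℚ.≤_)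
      (trans (solve 2 (λ k x → k :- x := (k :+ k) :- (x :+ k)) refl (+ K /1) (seq x n))
        (cong (ℚ._- (seq x n ℚ.+ + K /1)) (sym (/1-+ (+ K) (+ K)))))
      (∣p∣≤q⇒0≤q-p x≤K)) ∣x∣≤K)

    floor-x+K = floor-nonneg (K ℕ.+ K) x+K 0≤x+K x+K≤2K
    z         = proj₁ floor-x+K
    z-unit    = proj₂ floor-x+K

    shift : ∀ n → (seq x n ℚ.+ + K /1) ℚ.- z /1 ≡ seq x n ℚ.- (z ℤ.- + K) /1
    shift n = trans (solve 3 (λ x k z → (x :+ k) :- z := x :- (z :- k)) refl (seq x n) (+ K /1) (z /1))
      (cong (λ q → seq x n ℚ.- q) (sym (/1-- z (+ K))))

  ℝ-orderedℚAlgebra : OrderedℚAlgebra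
  ℝ-orderedℚAlgebra = record
    { algebra = record
      { commutativeRing = ℝ-commutativeRing
      ; ι   = fromℚ
      ; ι-+ = λ _ _ → pointwise λ _ → refl
      ; ι-* = λ _ _ → pointwise λ _ → refl
      ; ι-1 = pointwise λ _ → refl
      }
    ; NonNegative = Nonneg
    ; nonNeg-resp = nonneg-resp
    ; nonNeg-+    = λ {x} {y} → nonneg-+ {x} {y}
    ; nonNeg-*    = λ {x} {y} → nonneg-* {x} {y}
    ; nonNeg-ι    = λ {q} 0≤q → eventually-nonneg {fromℚ q} (0 , λ _ _ → 0≤q)
    ; floor       = floorᴿ
    }

-- Arithmetic of the bounds (n - 1)/(n + 1)

/-*-cancel : ∀ n d .{{_ : ℕ.NonZero d}} → (n ℚ./ d) ℚ.* + d /1 ≡ n /1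
/-*-cancel n d@(suc d-1) = ℚ.toℚᵘ-injective (begin
  ℚ.toℚᵘ ((n ℚ./ d) ℚ.* + d /1)                   ≈⟨ ℚ.toℚᵘ-homo-* (n ℚ./ d) (+ d /1) ⟩
  ℚ.toℚᵘ (n ℚ./ d) ℚᵘ.* ℚ.toℚᵘ (+ d /1)           ≈⟨ ℚᵘ.*-cong (ℚ.toℚᵘ-fromℚᵘ (ℚᵘ.mkℚᵘ n d-1)) (toℚᵘ-/1 (+ d)) ⟩
  ℚᵘ.mkℚᵘ n d-1 ℚᵘ.* ℚᵘ.mkℚᵘ (+ d) 0              ≈⟨ ℚᵘ.*≡* (trans (ℤ.*-identityʳ (n ℤ.* + d))
                                                       (cong (λ m → n ℤ.* + m) (sym (ℕ.*-identityʳ d)))) ⟩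
  ℚᵘ.mkℚᵘ n 0                                     ≈⟨ toℚᵘ-/1 n ⟨
  ℚ.toℚᵘ (n /1)                                   ∎)
  where open import Relation.Binary.Reasoning.Setoid ℚᵘ.≃-setoid

ratio : ℕ → ℚ
ratio m = + (m ∸ 1) ℚ./ suc m



ratio-nonneg : ∀ m → 0ℚ ℚ.≤ ratio m
ratio-nonneg m = ℚ.nonNegative⁻¹ (ratio m) {{ℚ.normalize-nonNeg (m ∸ 1) (suc m)}}

ratio-positive : ∀ m → 0ℚ ℚ.< ratio (suc (suc m))
ratio-positive m = ℚ.positive⁻¹ (ratio (suc (suc m))) {{ℚ.normalize-pos (suc m) (suc (suc (suc m)))}}

-- 1/N, for N = C(n+1, 2), is exactly the gap between the bounds for n and n − 1.
gap : ℕ → ℚ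
gap d = ratio (suc (suc d)) ℚ.- ratio (suc d)

-- With n = d + 2 the gap is (n - 1)/(n + 1) - (n - 2)/n = 2/(n(n + 1)). The factor ½ taken out at
-- the start turns N into 2N = n(n + 1), which clears both denominators.
gap-*-N : ∀ d → gap d ℚ.* + (suc (suc (suc d)) C 2) /1 ≡ 1ℚ
gap-*-N d = begin
  gap d ℚ.* + N /1
    ≡⟨ solve 2 (λ g n → g :* n := con ½ :* (g :* (con 2ℚ :* n))) refl (gap d) (+ N /1) ⟩
  ½ ℚ.* (gap d ℚ.* (2ℚ ℚ.* + N /1))
    ≡⟨ cong (λ q → ½ ℚ.* (gap d ℚ.* q)) 2N≡ ⟩
  ½ ℚ.* ((ratio (suc (suc d)) ℚ.- ratio (suc d)) ℚ.* (+ suc (suc d) /1 ℚ.* + suc (suc (suc d)) /1))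
    ≡⟨ solve 4 (λ r s a b → con ½ :* ((r :- s) :* (a :* b)) := con ½ :* ((r :* b) :* a :- (s :* a) :* b)) refl
         (ratio (suc (suc d))) (ratio (suc d)) (+ suc (suc d) /1) (+ suc (suc (suc d)) /1) ⟩
  ½ ℚ.* ((ratio (suc (suc d)) ℚ.* + suc (suc (suc d)) /1) ℚ.* + suc (suc d) /1
    ℚ.- (ratio (suc d) ℚ.* + suc (suc d) /1) ℚ.* + suc (suc (suc d)) /1)
    ≡⟨ cong₂ (λ p q → ½ ℚ.* (p ℚ.* + suc (suc d) /1 ℚ.- q ℚ.* + suc (suc (suc d)) /1))
         (/-*-cancel (+ suc d) (suc (suc (suc d)))) (/-*-cancel (+ d) (suc (suc d))) ⟩
  ½ ℚ.* (+ suc d /1 ℚ.* + suc (suc d) /1 ℚ.- + d /1 ℚ.* + suc (suc (suc d)) /1)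
    ≡⟨ cong₂ (λ p q → ½ ℚ.* (p ℚ.- + d /1 ℚ.* q)) (cong₂ ℚ._*_ 1+d 2+d) (trans (/1-+ 1ℤ (+ suc (suc d))) (cong (λ q → 1ℚ ℚ.+ q) 2+d)) ⟩
  ½ ℚ.* ((1ℚ ℚ.+ + d /1) ℚ.* (1ℚ ℚ.+ (1ℚ ℚ.+ + d /1)) ℚ.- + d /1 ℚ.* (1ℚ ℚ.+ (1ℚ ℚ.+ (1ℚ ℚ.+ + d /1))))
    ≡⟨ solve 1 (λ d → let 1+ = λ x → con 1ℚ :+ x in
         con ½ :* (1+ d :* 1+ (1+ d) :- d :* 1+ (1+ (1+ d))) := con 1ℚ) refl (+ d /1) ⟩
  1ℚ ∎
  where
  open ≡.≡-Reasoning
  open ℚSolver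
  N = suc (suc (suc d)) C 2
  2ℚ = + 2 /1
  1+d = /1-+ 1ℤ (+ d)
  2+d = trans (/1-+ 1ℤ (+ suc d)) (cong (λ q → 1ℚ ℚ.+ q) 1+d)
  2N≡ : 2ℚ ℚ.* + N /1 ≡ + suc (suc d) /1 ℚ.* + suc (suc (suc d)) /1
  2N≡ = begin
    2ℚ ℚ.* + N /1                                    ≡⟨ /1-* (+ 2) (+ N) ⟨
    (+ 2 ℤ.* + N) /1                                 ≡⟨ cong _/1 (ℤ.pos-* 2 N) ⟨
    + (2 ℕ.* N) /1                                   ≡⟨ cong (λ m → + m /1) (2*[1+n]C2≡n*[1+n] (suc (suc d))) ⟩
    + (suc (suc d) ℕ.* suc (suc (suc d))) /1         ≡⟨ cong _/1 (ℤ.pos-* (suc (suc d)) (suc (suc (suc d)))) ⟩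
    (+ suc (suc d) ℤ.* + suc (suc (suc d))) /1       ≡⟨ /1-* (+ suc (suc d)) (+ suc (suc (suc d))) ⟩
    + suc (suc d) /1 ℚ.* + suc (suc (suc d)) /1      ∎

C2-nonZero : ∀ d → ℕ.NonZero (suc (suc (suc d)) C 2)
C2-nonZero d = ℕ.≢-nonZero λ N≡0 → ℕ.1+n≢0 (trans (sym (2*[1+n]C2≡n*[1+n] (suc (suc d)))) (cong (2 ℕ.*_) N≡0))

gap-nonneg : ∀ d → 0ℚ ℚ.≤ gap d
gap-nonneg d = ℚ.*-cancelʳ-≤-pos (+ N /1) {{ℚ.normalize-pos N 1 {{_}} {{C2-nonZero d}}}}
  (subst₂ ℚ._≤_ (sym (ℚ.*-zeroˡ (+ N /1))) (sym (gap-*-N d)) (ℚ.nonNegative⁻¹ 1ℚ))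
  where N = suc (suc (suc d)) C 2

-- Coverings of real space and the lattice point bound

module ≋ = IsEquivalence ≋-isEquivalence

module _ (em : ExcludedMiddle 0ℓ) where

  open OrderedℚAlgebraProperties (ℝ-orderedℚAlgebra em)

  private
    module A = OrderedℚAlgebra (ℝ-orderedℚAlgebra em)

  -- Here and below, the η-expanded proofs of _≈ᴿ_ and _≤ᴿ_ keep the type
  -- checker from comparing real numbers together with their Cauchy proofs.
  Σᴿ≋combination : ∀ {m d} (u : Vector (Vector ℤ d) m) (t : Vector ℝ m) j →
    Σᴿ (λ i → t i *ᴿ fromℤ (u i j)) ≋ combination u t j
  Σᴿ≋combination u t j = sum≈combination u t j (λ i → t i *ᴿ fromℤ (u i j)) λ i → pointwise λ n → refl

  ≤1⇒nonneg : ∀ t → t ≤ᴿ 1ᴿ → A.NonNegative (A.ι 1ℚ A.- t)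
  ≤1⇒nonneg t t≤1 ε ε>0 = ≤ᴿ⇒nonneg {t} {1ᴿ} t≤1 ε ε>0

  nonneg⇒≤1 : ∀ t → A.NonNegative (A.ι 1ℚ A.- t) → t ≤ᴿ 1ᴿ
  nonneg⇒≤1 t t≤1 = nonneg⇒≤ᴿ {t} {1ᴿ} λ ε ε>0 → t≤1 ε ε>0

  zonotope⇒inZonotope : ∀ {m d} (u : Vector (Vector ℤ d) m) y → Zonotope u y → InZonotope u y
  zonotope⇒inZonotope u y (t , box , y≈) =
    t , (λ i → proj₁ (box i) , ≤1⇒nonneg (t i) (proj₂ (box i)))
      , λ j → ≋.trans {y j} (wrap (y≈ j)) (Σᴿ≋combination u t j)

  inZonotope⇒zonotope : ∀ {m d} (u : Vector (Vector ℤ d) m) y → InZonotope u y → Zonotope u y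
  inZonotope⇒zonotope u y (t , box , y≈) =
    t , (λ i → proj₁ (box i) , nonneg⇒≤1 (t i) (proj₂ (box i)))
      , λ j → unwrap (≋.trans {y j} (y≈ j) (≋.sym (Σᴿ≋combination u t j)))

  covers⇒scaled : ∀ {m d} (u : Vector (Vector ℤ d) m) μ → Covers μ (Zonotope u) → ScaledZonotopeCovers μ u
  covers⇒scaled u μ cov x =
    let y , z , y∈Z , x≈ = cov x
    in y , z , zonotope⇒inZonotope u y y∈Z , λ j → wrap λ ε ε>0 → x≈ j ε ε>0

  scaled⇒covers : ∀ {m d} (u : Vector (Vector ℤ d) m) μ → ScaledZonotopeCovers μ u → Covers μ (Zonotope u)
  scaled⇒covers u μ cov x =
    let y , z , y∈Z , x≈ = cov x
    in y , z , inZonotope⇒zonotope u y y∈Z , λ j ε ε>0 → unwrap (x≈ j) ε ε>0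

  0<⇒nonneg : ∀ μ → 0ᴿ <ᴿ μ → Nonneg μ
  0<⇒nonneg μ (ε , ε>0 , 0+ε≤μ) = eventually-nonneg {μ}
    (mapᴱ (λ n → ℚ.≤-trans (ℚ.<⇒≤ (subst (0ℚ ℚ.<_) (sym (ℚ.+-identityˡ ε)) ε>0))) 0+ε≤μ)

  coveringRadius⇒zonotopeCovers : ∀ {m d} {ρ} (u : Vector (Vector ℤ (suc d)) m) →
    ∃[ μ ] IsCoveringRadius (Zonotope u) μ × μ ≤ᴿ fromℚ ρ → ZonotopeCovers ρ u
  coveringRadius⇒zonotopeCovers {ρ = ρ} u (μ , ((0<μ , cov) , _) , μ≤ρ) =
    scaled⇒zonotopeCovers {ρ = ρ} {μ} u (0<⇒nonneg μ 0<μ , ≤ᴿ⇒nonneg {μ} {fromℚ ρ} μ≤ρ) (covers⇒scaled u μ cov)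

  conjectureC⇒zonotopeCovers : ∀ d → ConjectureC (suc d) →
    (v : Vector ℕ (suc d)) (u : Vector (Vector ℤ d) (suc d)) → IsSLRZ v u → ZonotopeCovers (ratio (suc d)) u
  -- One runner: in dimension 0 `IsCoveringRadius` asserts no covering. There are no coordinates to
  -- be matched, and the coefficient 0 is admissible even though `ratio 1` is 0.
  conjectureC⇒zonotopeCovers zero _ v u _ x =
    (λ _ → 0ᴿ) , (λ ()) , (λ _ → proj₁ (proj₂ (proj₂ (within-0 (ratio-nonneg 1))))) , λ ()
  conjectureC⇒zonotopeCovers (suc d) conjectureC v u slrz =
    coveringRadius⇒zonotopeCovers {ρ = ratio (suc (suc d))} u (conjectureC v u slrz)

  -- Coefficients in [0, ρ] have to be divided by `ρ` to give a point of the zonotope itself, hence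
  -- the strict inequality.
  zonotopeCovers⇒covers : ∀ {m d} (u : Vector (Vector ℤ d) m) ρ μ → 0ℚ ℚ.< ρ → (∀ n → seq μ n ≡ ρ) →
    ZonotopeCovers ρ u → Covers μ (Zonotope u)
  zonotopeCovers⇒covers u ρ μ ρ>0 μ≡ρ cov =
    let δ , δ>0 , ρδ≡1 = B*δ≡ε ρ 1ℚ ρ>0 (ℚ.positive⁻¹ 1ℚ)
    in scaled⇒covers u μ (zonotopeCovers⇒scaled ρ δ μ u (ℚ.<⇒≤ δ>0) ρδ≡1 (pointwise μ≡ρ) cov)

  manyPoints⇒covers : ∀ d → ConjectureC (suc d) → LonelyVectorProperty (suc (suc d)) →
    (v : Vector ℕ (suc (suc d))) (u : Vector (Vector ℤ (suc d)) (suc (suc d))) → IsSLRZ v u →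
    ∀ k (p : Vector (Vector ℤ (suc d)) k) → Injective _≡_ _≗_ p → (∀ i → Zonotope u (λ j → fromℤ (p i j))) →
    (suc (suc (suc d)) C 2) ^ suc d ℕ.< k → Covers (bound (suc (suc d))) (Zonotope u)
  manyPoints⇒covers d conjectureC lvp v u slrz k p p-injective p∈Z N^d<k =
    zonotopeCovers⇒covers u (ratio (suc (suc d))) (bound (suc (suc d))) (ratio-positive d) (λ _ → refl) (subst (λ ρ → ZonotopeCovers ρ u) ρ₁+gap≡ρ₂
      (congruentPoints⇒covers (ratio-nonneg (suc d)) (conjectureC⇒zonotopeCovers d conjectureC)
        v positive distinct lvp u generates relation (+ N) (gap d) (gap-nonneg d) (gap-*-N d)
        (p a) (p b) W pa≡pb+NW W≢0
        (zonotope⇒inZonotope u (λ j → fromℤ (p a j)) (p∈Z a)) (zonotope⇒inZonotope u (λ j → fromℤ (p b j)) (p∈Z b))))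
    where
    open IsSLRZ slrz
    N = suc (suc (suc d)) C 2
    pigeons = congruent-pair N {{C2-nonZero d}} p N^d<k
    a = proj₁ pigeons
    b = proj₁ (proj₂ pigeons)
    a≢b = proj₁ (proj₂ (proj₂ pigeons))
    W = proj₁ (proj₂ (proj₂ (proj₂ pigeons)))
    pa≡pb+NW = proj₂ (proj₂ (proj₂ (proj₂ pigeons)))

    ρ₁+gap≡ρ₂ : ratio (suc d) ℚ.+ gap d ≡ ratio (suc (suc d))
    ρ₁+gap≡ρ₂ = ℚSolver.solve 2 (λ r s → s ℚSolver.:+ (r ℚSolver.:- s) ℚSolver.:= r) refl (ratio (suc (suc d))) (ratio (suc d))

    W≢0 : ¬ (∀ j → W j ≡ 0ℤ)
    W≢0 W≡0 = a≢b (p-injective λ j → trans (pa≡pb+NW j)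
      (trans (cong (λ w → p b j ℤ.+ + N ℤ.* w) (W≡0 j))
        (trans (cong (λ z → p b j ℤ.+ z) (ℤ.*-zeroʳ (+ N))) (ℤ.+-identityʳ (p b j)))))

<ᴿ⇒≱ᴿ : ∀ {x y} → x <ᴿ y → ¬ y ≤ᴿ x
<ᴿ⇒≱ᴿ {x} {y} (ε , ε>0 , x+ε≤y) y≤x =
  ℚ.<-irrefl refl (begin-strict
    seq x N ℚ.+ ½ ℚ.* ε     <⟨ ℚ.+-monoʳ-< (seq x N) ½ε<ε ⟩
    seq x N ℚ.+ ε           ≤⟨ proj₁ (proj₂ both N ℕ.≤-refl) ⟩
    seq y N                 ≤⟨ proj₂ (proj₂ both N ℕ.≤-refl) ⟩
    seq x N ℚ.+ ½ ℚ.* ε     ∎)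
  where
  open ℚ.≤-Reasoning
  both = x+ε≤y ∧ᴱ y≤x (½ ℚ.* ε) (0<½ε ε>0)
  N    = proj₁ both
  ½ε<ε : ½ ℚ.* ε ℚ.< ε
  ½ε<ε = subst₂ ℚ._<_ (ℚ.+-identityʳ (½ ℚ.* ε)) (½ε+½ε≡ε ε) (ℚ.+-monoʳ-< (½ ℚ.* ε) (0<½ε ε>0))

theorem2 : ExcludedMiddle 0ℓ →
    (n : ℕ) → 1 ≤ n →
    ConjectureC (n ∸ 1) →
    (∀ k → k ≤ n → LonelyVectorProperty k) →
    (v : Vector ℕ n) (u : Vector (Vector ℤ (n ∸ 1)) n) → IsSLRZ v u →
    (μ : ℝ) → IsCoveringRadius (Zonotope u) μ → bound n <ᴿ μ →
    AtMostLatticePoints ((suc n C 2) ^ (n ∸ 1)) (Zonotope u)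
-- For n = 1 the exponent is 0 and the bound 1, and two points of ℤ⁰ have no coordinate in which to
-- differ.
theorem2 em (suc zero) _ _ _ v u _ μ _ _ zero          p _           _ = ℕ.z≤n
theorem2 em (suc zero) _ _ _ v u _ μ _ _ (suc zero)    p _           _ = ℕ.s≤s ℕ.z≤n
theorem2 em (suc zero) _ _ _ v u _ μ _ _ (suc (suc k)) p p-injective _ =
  ⊥-elim (Fin.0≢1+n (p-injective {zero} {suc zero} λ ()))
theorem2 em (suc (suc d)) _ conjectureC lvp v u slrz μ (_ , minimal) bound<μ k p p-injective p∈Z =
  -- More points would make `bound` itself a covering factor, and `minimal` would then force `μ` to
  -- be at most `bound`.
  ℕ.≮⇒≥ λ N^d<k → <ᴿ⇒≱ᴿ {bound (suc (suc d))} {μ} bound<μ (minimal (bound (suc (suc d)))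
    (ratio (suc (suc d)) , ratio-positive d , 0 , λ _ _ → ℚ.≤-reflexive (ℚ.+-identityˡ (ratio (suc (suc d)))))
    (manyPoints⇒covers em d conjectureC (lvp (suc (suc d)) ℕ.≤-refl) v u slrz k p p-injective p∈Z N^d<k))
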